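{- For every fixed real $c>0$ there is (for each number of inputs $n$) a randomized polynomial decision tree of depth $O((\log n)^3)$ that, on any input $x_1,\dots,x_n\in\mathbb{R}$ (the values need not be pairwise distinct), outputs an index $i^{\star}\in[n]$ with $x_{i^{\star}}=\max_{1\le j\le n} x_j$ with failure probability $O(n^{ -c})$. Here the implied constants may depend on $c$ but not on $n$ or on the input.
   Context: $[n]=\{1,\dots,n\}$. A polynomial decision tree on inputs $x_1,\dots,x_n\in\mathbb{R}$ is a finite decision tree in which each internal node carries a polynomial $p\in\mathbb{R}[x_1,\dots,x_n]$ and performs the ternary test $p(x_1,\dots,x_n):0$, branching to one of three children according to whether $p(x_1,\dots,x_n)$ is $<0$, $=0$ or $>0$; each leaf carries an output (here, an index in $[n]$). The degrees of the polynomials are not restricted. The depth is the maximum number of tests on a root-to-leaf path. A randomized polynomial decision tree may in addition make random choices, independent of the input (equivalently, it is a probability distribution over deterministic polynomial decision trees); its depth is the maximum number of tests performed over all inputs and all random choices. Its failure probability on an input is the probability, over the random choices, that the output is not an index $i^{\star}$ with $x_{i^{\star}}=\max_j x_j$; the bound is required to hold for every input. -}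

module Defs where

open import Algebra.Bundles using (CommutativeRing)
import Algebra.Properties.CommutativeSemiring.Exp as Exp
import Algebra.Properties.Semiring.Mult as Mult
import Algebra.Properties.Semiring.Sum as Sum
open import Data.Bool.Base using (if_then_else_)
open import Data.Empty using (⊥-elim)
open import Data.Fin.Base using (Fin)
import Data.Fin.Properties as Fin
open import Data.Nat.Base as ℕ using (ℕ; zero; suc; NonZero; z≤n; s≤s)
import Data.Nat.Properties as ℕ
open import Data.Product.Base using (∃; _×_; _,_; proj₁; proj₂)
open import Data.Sum.Base using (inj₁; inj₂)
open import Data.Vec.Functional using (Vector; foldr; map)
open import Level using (Level)
open import Relation.Binary.Bundles using (StrictPartialOrder)
open import Relation.Binary.Core using (Rel)
open import Relation.Binary.Definitions using (Tri; tri<; tri≈; tri>)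
import Relation.Binary.Construct.StrictToNonStrict as StrictToNonStrict
import Relation.Binary.Reasoning.StrictPartialOrder as <-Reasoning
open import Relation.Binary.Structures using (IsStrictTotalOrder; IsDecTotalOrder)
open import Relation.Nullary.Decidable.Core using (Dec; does)
open import Relation.Nullary.Negation.Core using (¬_)
open import Relation.Unary using (Pred; Satisfiable)

private
  variable
    ℓ : Level

-- The real numbers, given by the axioms that determine them up to isomorphism.
-- Trichotomy is part of the structure, as a ternary test returns the sign of a
-- real number; this is the classical ℝ, whose construction needs excluded middle.
record CompleteOrderedField ℓ : Set (Level.suc ℓ) where
  infix 4 _<_
  field
    commutativeRing : CommutativeRing ℓ ℓ

  open CommutativeRing commutativeRing public

  field
    _<_                : Rel Carrier ℓ
    isStrictTotalOrder : IsStrictTotalOrder _≈_ _<_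
    0<1                : 0# < 1#
    +-monoˡ-<          : ∀ z {x y} → x < y → x + z < y + z
    *-pos              : ∀ {x y} → 0# < x → 0# < y → 0# < x * y
    inverse            : ∀ x → x ≉ 0# → ∃ λ y → x * y ≈ 1#

  open StrictToNonStrict _≈_ _<_ public using (_≤_)

  IsUpperBound : Pred Carrier ℓ → Carrier → Set ℓ
  IsUpperBound P b = ∀ {x} → P x → x ≤ b

  -- The second component makes s the least upper bound, in the form "no y below
  -- s bounds P" stated positively; classically the two forms are equivalent.
  IsSupremum : Pred Carrier ℓ → Carrier → Set ℓ
  IsSupremum P s = IsUpperBound P s × (∀ {y} → y < s → ∃ λ x → P x × y < x)

  field
    supremum : (P : Pred Carrier ℓ) → Satisfiable P → ∃ (IsUpperBound P) →
               ∃ (IsSupremum P)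

  open IsStrictTotalOrder isStrictTotalOrder public
    using (compare; isStrictPartialOrder)
    renaming (trans to <-trans; irrefl to <-irrefl; asym to <-asym;
              <-respʳ-≈ to <-respʳ; <-respˡ-≈ to <-respˡ)

  open IsDecTotalOrder (StrictToNonStrict.isDecTotalOrder _≈_ _<_ isStrictTotalOrder) public
    using (_≤?_) renaming (trans to ≤-trans)

  strictPartialOrder : StrictPartialOrder ℓ ℓ ℓ
  strictPartialOrder = record { isStrictPartialOrder = isStrictPartialOrder }

-- Real powers bˣ for b ≥ 1: the supremum of all bʳ with r rational and r ≤ x.
module RealPower (ℝ : CompleteOrderedField ℓ) where
  open CompleteOrderedField ℝ
  open Mult semiring using (×-homo-+; ×1-homo-*) renaming (_×_ to infixr 8 _·_)
  open Exp commutativeSemiring using (_^_; ^-homo-*; ^-assocʳ)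
  open <-Reasoning strictPartialOrder

  fromℕ : ℕ → Carrier
  fromℕ n = n · 1#

  -- y = b^((u − v) / q), that is, y is positive and y^q = b^(u − v).
  IsRationalPower : Carrier → (u v q : ℕ) → Carrier → Set ℓ
  IsRationalPower b u v q y = 0# < y × y ^ q * b ^ v ≈ b ^ u

  -- The inequality says (u − v) / q ≤ x.
  RationalPowersUpTo : (b x : Carrier) → Pred Carrier ℓ
  RationalPowersUpTo b x y =
    ∃ λ u → ∃ λ v → ∃ λ q →
      NonZero q × fromℕ u ≤ fromℕ q * x + fromℕ v × IsRationalPower b u v q y

  ≮⇒≥ : ∀ {x y} → ¬ x < y → y ≤ x
  ≮⇒≥ {x} {y} x≮y with compare x y
  ... | tri< x<y _ _ = ⊥-elim (x≮y x<y)
  ... | tri≈ _ x≈y _ = inj₂ (sym x≈y)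
  ... | tri> _ _ y<x = inj₁ y<x

  <⇒≱ : ∀ {x y} → x < y → ¬ y ≤ x
  <⇒≱ x<y (inj₁ y<x) = <-asym x<y y<x
  <⇒≱ x<y (inj₂ y≈x) = <-irrefl (sym y≈x) x<y

  +-monoʳ-< : ∀ z {x y} → x < y → z + x < z + y
  +-monoʳ-< z {x} {y} x<y = begin-strict
    z + x ≈⟨ +-comm z x ⟩
    x + z <⟨ +-monoˡ-< z x<y ⟩
    y + z ≈⟨ +-comm y z ⟩
    z + y ∎

  +-monoˡ-≤ : ∀ z {x y} → x ≤ y → x + z ≤ y + z
  +-monoˡ-≤ z (inj₁ x<y) = inj₁ (+-monoˡ-< z x<y)
  +-monoˡ-≤ z (inj₂ x≈y) = inj₂ (+-congʳ x≈y)

  +-monoʳ-≤ : ∀ z {x y} → x ≤ y → z + x ≤ z + y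
  +-monoʳ-≤ z (inj₁ x<y) = inj₁ (+-monoʳ-< z x<y)
  +-monoʳ-≤ z (inj₂ x≈y) = inj₂ (+-congˡ x≈y)

  x<y⇒0<y-x : ∀ {x y} → x < y → 0# < y - x
  x<y⇒0<y-x {x} x<y = <-respˡ (-‿inverseʳ x) (+-monoˡ-< (- x) x<y)

  *-monoˡ-< : ∀ {z} → 0# < z → ∀ {x y} → x < y → x * z < y * z
  *-monoˡ-< {z} 0<z {x} {y} x<y = begin-strict
    x * z                   ≈⟨ +-identityˡ _ ⟨
    0# + x * z              <⟨ +-monoˡ-< (x * z) (*-pos (x<y⇒0<y-x x<y) 0<z) ⟩
    (y - x) * z + x * z     ≈⟨ distribʳ z (y - x) x ⟨
    (y - x + x) * z         ≈⟨ *-congʳ (+-assoc y (- x) x) ⟩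
    (y + (- x + x)) * z     ≈⟨ *-congʳ (+-congˡ (-‿inverseˡ x)) ⟩
    (y + 0#) * z            ≈⟨ *-congʳ (+-identityʳ y) ⟩
    y * z                   ∎

  *-monoʳ-< : ∀ {z} → 0# < z → ∀ {x y} → x < y → z * x < z * y
  *-monoʳ-< {z} 0<z {x} {y} x<y = begin-strict
    z * x ≈⟨ *-comm z x ⟩
    x * z <⟨ *-monoˡ-< 0<z x<y ⟩
    y * z ≈⟨ *-comm y z ⟩
    z * y ∎

  *-monoˡ-≤ : ∀ {z} → 0# < z → ∀ {x y} → x ≤ y → x * z ≤ y * z
  *-monoˡ-≤ 0<z (inj₁ x<y) = inj₁ (*-monoˡ-< 0<z x<y)
  *-monoˡ-≤ 0<z (inj₂ x≈y) = inj₂ (*-congʳ x≈y)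

  ^-pos : ∀ {b} → 0# < b → ∀ k → 0# < b ^ k
  ^-pos 0<b zero    = 0<1
  ^-pos 0<b (suc k) = *-pos 0<b (^-pos 0<b k)

  ^-monoˡ-< : ∀ {a b} → 0# < a → a < b → ∀ q → a ^ suc q < b ^ suc q
  ^-monoˡ-< {a} {b} 0<a a<b zero    = *-monoˡ-< 0<1 a<b
  ^-monoˡ-< {a} {b} 0<a a<b (suc q) = begin-strict
    a * a ^ suc q <⟨ *-monoʳ-< 0<a (^-monoˡ-< 0<a a<b q) ⟩
    a * b ^ suc q <⟨ *-monoˡ-< (^-pos (<-trans 0<a a<b) (suc q)) a<b ⟩
    b * b ^ suc q ∎

  1≤⇒0< : ∀ {b} → 1# ≤ b → 0# < b
  1≤⇒0< {b} 1≤b = begin-strict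
    0# <⟨ 0<1 ⟩
    1# ≤⟨ 1≤b ⟩
    b  ∎

  ^-monoʳ-≤ : ∀ {b} → 1# ≤ b → ∀ {i j} → i ℕ.≤ j → b ^ i ≤ b ^ j
  ^-monoʳ-≤ {b} 1≤b {j = zero} z≤n = inj₂ refl
  ^-monoʳ-≤ {b} 1≤b {j = suc j} z≤n = begin
    1#         ≤⟨ ^-monoʳ-≤ 1≤b {j = j} z≤n ⟩
    b ^ j      ≈⟨ *-identityˡ _ ⟨
    1# * b ^ j ≤⟨ *-monoˡ-≤ (^-pos (1≤⇒0< 1≤b) j) 1≤b ⟩
    b * b ^ j  ∎
  ^-monoʳ-≤ {b} 1≤b {suc i} {suc j} (s≤s i≤j) = begin
    b * b ^ i ≈⟨ *-comm b _ ⟩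
    b ^ i * b ≤⟨ *-monoˡ-≤ (1≤⇒0< 1≤b) (^-monoʳ-≤ 1≤b i≤j) ⟩
    b ^ j * b ≈⟨ *-comm _ b ⟩
    b * b ^ j ∎

  0≤fromℕ : ∀ n → 0# ≤ fromℕ n
  0≤fromℕ zero    = inj₂ refl
  0≤fromℕ (suc n) = inj₁ (begin-strict
    0#           <⟨ 0<1 ⟩
    1#           ≈⟨ +-identityʳ 1# ⟨
    1# + 0#      ≤⟨ +-monoʳ-≤ 1# (0≤fromℕ n) ⟩
    1# + fromℕ n ∎)

  fromℕ-mono-< : ∀ {m n} → m ℕ.< n → fromℕ m < fromℕ n
  fromℕ-mono-< {zero} {suc n} _ = begin-strict
    0#           <⟨ 0<1 ⟩
    1#           ≈⟨ +-identityʳ 1# ⟨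
    1# + 0#      ≤⟨ +-monoʳ-≤ 1# (0≤fromℕ n) ⟩
    1# + fromℕ n ∎
  fromℕ-mono-< {suc m} {suc n} (s≤s m<n) = +-monoʳ-< 1# (fromℕ-mono-< m<n)

  fromℕ-cancel-≤ : ∀ {m n} → fromℕ m ≤ fromℕ n → m ℕ.≤ n
  fromℕ-cancel-≤ m≤n = ℕ.≮⇒≥ λ n<m → <⇒≱ (fromℕ-mono-< n<m) m≤n

  1≤fromℕ : ∀ n .{{_ : NonZero n}} → 1# ≤ fromℕ n
  1≤fromℕ (suc n) = begin
    1#           ≈⟨ +-identityʳ 1# ⟨
    1# + 0#      ≤⟨ +-monoʳ-≤ 1# (0≤fromℕ n) ⟩
    1# + fromℕ n ∎

  archimedean : ∀ x → ∃ λ k → x < fromℕ k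
  archimedean x with compare x 0#
  ... | tri< x<0 _ _ = 0 , x<0
  ... | tri≈ _ x≈0 _ = 1 , <-respˡ (sym x≈0) (fromℕ-mono-< {0} {1} (s≤s z≤n))
  ... | tri> _ _ 0<x = go (approx s-1<s)
    where
    P : Pred Carrier _
    P y = ∃ λ k → y ≈ fromℕ k × y ≤ x

    sup = supremum P (0# , 0 , refl , inj₁ 0<x) (x , λ (_ , _ , y≤x) → y≤x)
    s      = proj₁ sup
    upper  = proj₁ (proj₂ sup)
    approx = proj₂ (proj₂ sup)

    s-1<s : s - 1# < s
    s-1<s = begin-strict
      s - 1#          ≈⟨ +-identityʳ _ ⟨
      s - 1# + 0#     <⟨ +-monoʳ-< (s - 1#) 0<1 ⟩
      s - 1# + 1#     ≈⟨ +-assoc s (- 1#) 1# ⟩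
      s + (- 1# + 1#) ≈⟨ +-congˡ (-‿inverseˡ 1#) ⟩
      s + 0#          ≈⟨ +-identityʳ s ⟩
      s               ∎

    go : (∃ λ y → P y × s - 1# < y) → ∃ λ k → x < fromℕ k
    go (y , (k , y≈k , _) , s-1<y) with compare x (fromℕ (suc k))
    ... | tri< x<k+1 _ _ = suc k , x<k+1
    ... | tri≈ _ x≈k+1 _ = 2 ℕ.+ k , <-respˡ (sym x≈k+1) (fromℕ-mono-< (ℕ.n<1+n (suc k)))
    ... | tri> _ _ k+1<x = ⊥-elim (<⇒≱ s<k+1 (upper (suc k , refl , inj₁ k+1<x)))
      where
      s<k+1 : s < fromℕ (suc k)
      s<k+1 = begin-strict
        s                ≈⟨ +-identityʳ s ⟨
        s + 0#           ≈⟨ +-congˡ (-‿inverseˡ 1#) ⟨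
        s + (- 1# + 1#)  ≈⟨ +-assoc s (- 1#) 1# ⟨
        s - 1# + 1#      <⟨ +-monoˡ-< 1# s-1<y ⟩
        y + 1#           ≈⟨ +-congʳ y≈k ⟩
        fromℕ k + 1#     ≈⟨ +-comm _ 1# ⟩
        fromℕ (suc k)    ∎

  inverse-pos : ∀ {x y} → 0# < x → x * y ≈ 1# → 0# < y
  inverse-pos {x} {y} 0<x xy≈1 with compare 0# y
  ... | tri< 0<y _ _ = 0<y
  ... | tri≈ _ 0≈y _ = ⊥-elim (<-irrefl 0≈1 0<1)
    where
    0≈1 : 0# ≈ 1#
    0≈1 = trans (trans (sym (zeroʳ x)) (*-congˡ 0≈y)) xy≈1
  ... | tri> _ _ y<0 = ⊥-elim (<-asym 0<1 (begin-strict
    1#     ≈⟨ xy≈1 ⟨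
    x * y  <⟨ *-monoʳ-< 0<x y<0 ⟩
    x * 0# ≈⟨ zeroʳ x ⟩
    0#     ∎))

  nonempty : ∀ {b} → 1# ≤ b → ∀ x → Satisfiable (RationalPowersUpTo b x)
  nonempty {b} 1≤b x with archimedean (- x)
  ... | k , -x<k with inverse (b ^ k) (λ b^k≈0 → <-irrefl (sym b^k≈0) (^-pos (1≤⇒0< 1≤b) k))
  ...   | y , b^k*y≈1 =
    y , 0 , k , 1 , _ , inj₁ 0<1*x+k , inverse-pos (^-pos (1≤⇒0< 1≤b) k) b^k*y≈1 , y^1*b^k≈1
    where
    0<1*x+k : 0# < fromℕ 1 * x + fromℕ k
    0<1*x+k = begin-strict
      0#                    ≈⟨ -‿inverseʳ x ⟨
      x - x                 <⟨ +-monoʳ-< x -x<k ⟩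
      x + fromℕ k           ≈⟨ +-congʳ (*-identityˡ x) ⟨
      1# * x + fromℕ k      ≈⟨ +-congʳ (*-congʳ (+-identityʳ 1#)) ⟨
      fromℕ 1 * x + fromℕ k ∎

    y^1*b^k≈1 : y ^ 1 * b ^ k ≈ b ^ 0
    y^1*b^k≈1 = trans (*-congʳ (*-identityʳ y)) (trans (*-comm y _) b^k*y≈1)

  bounded : ∀ {b} → 1# ≤ b → ∀ x → ∃ (IsUpperBound (RationalPowersUpTo b x))
  bounded {b} 1≤b x with archimedean x
  ... | k , x<k = b ^ k , λ {y} → bound {y}
    where
    bound : IsUpperBound (RationalPowersUpTo b x) (b ^ k)
    bound {y} (u , v , suc q , _ , u≤qx+v , 0<y , y^q*b^v≈b^u) = ≮⇒≥ λ b^k<y →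
      <⇒≱ (tooBig b^k<y) (^-monoʳ-≤ 1≤b (fromℕ-cancel-≤ {u} {k ℕ.* suc q ℕ.+ v} u≤kq+v))
      where
      0<b = 1≤⇒0< 1≤b

      u≤kq+v : fromℕ u ≤ fromℕ (k ℕ.* suc q ℕ.+ v)
      u≤kq+v = begin
        fromℕ u                           ≤⟨ u≤qx+v ⟩
        fromℕ (suc q) * x + fromℕ v       <⟨ +-monoˡ-< (fromℕ v) (*-monoʳ-< (1≤⇒0< (1≤fromℕ (suc q))) x<k) ⟩
        fromℕ (suc q) * fromℕ k + fromℕ v ≈⟨ +-congʳ (*-comm _ _) ⟩
        fromℕ k * fromℕ (suc q) + fromℕ v ≈⟨ +-congʳ (×1-homo-* k (suc q)) ⟨
        fromℕ (k ℕ.* suc q) + fromℕ v     ≈⟨ ×-homo-+ 1# (k ℕ.* suc q) v ⟨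
        fromℕ (k ℕ.* suc q ℕ.+ v)         ∎

      tooBig : b ^ k < y → b ^ (k ℕ.* suc q ℕ.+ v) < b ^ u
      tooBig b^k<y = begin-strict
        b ^ (k ℕ.* suc q ℕ.+ v)   ≈⟨ ^-homo-* b (k ℕ.* suc q) v ⟩
        b ^ (k ℕ.* suc q) * b ^ v ≈⟨ *-congʳ (^-assocʳ b k (suc q)) ⟨
        (b ^ k) ^ suc q * b ^ v   <⟨ *-monoˡ-< (^-pos 0<b v) (^-monoˡ-< (^-pos 0<b k) b^k<y q) ⟩
        y ^ suc q * b ^ v         ≈⟨ y^q*b^v≈b^u ⟩
        b ^ u                     ∎

  power : (b : Carrier) → 1# ≤ b → Carrier → Carrier
  power b 1≤b x = proj₁ (supremum (RationalPowersUpTo b x) (nonempty 1≤b x) (bounded 1≤b x))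

  infixr 8 _^ʳ_
  _^ʳ_ : (n : ℕ) .{{_ : NonZero n}} → Carrier → Carrier
  n ^ʳ x = power (fromℕ n) (1≤fromℕ n) x

module PolynomialDecisionTree (ℝ : CompleteOrderedField ℓ) where
  open CompleteOrderedField ℝ
  open Sum semiring using (sum)

  infixl 6 _⊕_
  infixl 7 _⊗_

  -- Distinct expressions may denote the same polynomial; a tree depends only on
  -- the values of the polynomials it tests.
  data Polynomial (n : ℕ) : Set ℓ where
    con : Carrier → Polynomial n
    var : Fin n → Polynomial n
    _⊕_ : Polynomial n → Polynomial n → Polynomial n
    _⊗_ : Polynomial n → Polynomial n → Polynomial n

  ⟦_⟧ : ∀ {n} → Polynomial n → Vector Carrier n → Carrier
  ⟦ con a ⟧ x = a
  ⟦ var i ⟧ x = x i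
  ⟦ p ⊕ q ⟧ x = ⟦ p ⟧ x + ⟦ q ⟧ x
  ⟦ p ⊗ q ⟧ x = ⟦ p ⟧ x * ⟦ q ⟧ x

  data Tree (n : ℕ) : Set ℓ where
    leaf : Fin n → Tree n
    test : Polynomial n → (t< t≈ t> : Tree n) → Tree n

  depth : ∀ {n} → Tree n → ℕ
  depth (leaf _)          = 0
  depth (test _ t< t≈ t>) = suc (depth t< ℕ.⊔ depth t≈ ℕ.⊔ depth t>)

  mutual
    output : ∀ {n} → Tree n → Vector Carrier n → Fin n
    output (leaf i)          x = i
    output (test p t< t≈ t>) x = branch (compare (⟦ p ⟧ x) 0#) t< t≈ t> x

    branch : ∀ {n} {a b : Carrier} → Tri (a < b) (a ≈ b) (b < a) →
             (t< t≈ t> : Tree n) → Vector Carrier n → Fin n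
    branch (tri< _ _ _) t< t≈ t> x = output t< x
    branch (tri≈ _ _ _) t< t≈ t> x = output t≈ x
    branch (tri> _ _ _) t< t≈ t> x = output t> x

  IsMaximum : ∀ {n} → Vector Carrier n → Fin n → Set ℓ
  IsMaximum x i = ∀ j → x j ≤ x i

  isMaximum? : ∀ {n} (x : Vector Carrier n) i → Dec (IsMaximum x i)
  isMaximum? x i = Fin.all? λ j → x j ≤? x i

  -- A finitely supported probability distribution, with real weights, over
  -- deterministic trees.
  record RandomizedTree (n : ℕ) : Set ℓ where
    field
      size       : ℕ
      tree       : Vector (Tree n) size
      weight     : Vector Carrier size
      weight≥0   : ∀ k → 0# ≤ weight k
      sum-weight : sum weight ≈ 1#

    randomizedDepth : ℕ
    randomizedDepth = foldr ℕ._⊔_ 0 (map depth tree)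

    failureProbability : Vector Carrier n → Carrier
    failureProbability x =
      sum λ k → if does (isMaximum? x (output (tree k) x)) then 0# else weight k

{-# OPTIONS --safe #-}

-- For a candidate i let Φ(i) be the number of j with xᵢ < xⱼ. A product of the
-- differences xᵢ − xⱼ over a set S has a sign that tells the parity of the number of
-- j ∈ S with xᵢ < xⱼ, and ties are neutralised by an elementary symmetric
-- polynomial whose degree, the number of entries different from xᵢ, is found by
-- binary search. If S contains exactly one such j, the parities of the sets
-- {j ∈ S : a given bit of j is 1} spell out j with O(log n) tests.
-- One round takes random sets of density 1/2, 1/4, …, 1/O(n) and moves to the best
-- index found. A set whose density is about 1/Φ(i) isolates each j above xᵢ with
-- probability at least 1/(8 Φ(i)), and on average such a j halves Φ, so a round of
-- O((log n)²) tests shrinks Φ to at most 15/16 Φ(i) in expectation. After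
-- O(c log n) rounds the expectation of Φ is at most n^(−c), and by Markov's inequality
-- this bounds the probability that the final index is not a maximum.
module Submission where

open import Defs
import Algebra.Properties.CommutativeSemiring.Exp as Exp
import Algebra.Properties.Ring as RingProperties
import Algebra.Properties.Semiring.Mult as Mult
import Algebra.Properties.Semiring.Sum as Sum
open import Data.Bool.Base using (Bool; true; false; _∧_; not; if_then_else_)
import Data.Bool.Properties as Bool
open import Data.Empty using (⊥-elim)
open import Data.Fin.Base using (Fin; zero; suc; fromℕ<; inject≤; combine; finToFun; funToFin)
import Data.Fin.Properties as Fin
open import Data.List.Base as List using (List; []; _∷_; _++_; map; length; allFin; tabulate; cartesianProductWith)
open import Data.List.Properties using (length-tabulate)
open import Data.Nat.Base as ℕ using (ℕ; zero; suc; NonZero; z≤n; s≤s)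
open import Data.Nat.Logarithm using (⌊log₂_⌋; ⌊log₂⌋-mono-≤; ⌊log₂[2^n]⌋≡n)
import Data.Nat.Properties as ℕ
open import Data.Nat.Tactic.RingSolver using (solve-∀)
open import Data.Product.Base using (∃; _×_; _,_; proj₁; proj₂)
open import Data.Sum.Base using (inj₁; inj₂)
open import Data.Unit.Base using (tt)
open import Data.Vec.Base as Vec using (Vec; []; _∷_)
open import Data.Vec.Functional as Vector using (Vector)
open import Function.Base using (_∘_; id)
open import Level using (Level)
open import Relation.Binary.Definitions using (tri<; tri≈; tri>)
open import Relation.Binary.PropositionalEquality as ≡ using (_≡_; _≢_; cong; subst)
import Relation.Binary.Reasoning.StrictPartialOrder as <-Reasoning
open import Relation.Binary.Structures using (IsStrictTotalOrder)
open import Relation.Nullary.Decidable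
  using (Dec; yes; no; does; dec-true; dec-false; ¬?; _×-dec_; _→-dec_)
open import Relation.Nullary.Negation using (¬_)
open import Relation.Unary using (Pred; Decidable)

private
  variable
    ℓ a p : Level
    A B C : Set a

-- Finite sums and counting over uniform tuples.

module FiniteSums where
  open import Data.Nat.Base using (_+_; _*_; _^_; _≤_)
  open import Data.Nat.Properties
  open ≡ hiding ([_])

  ∑ : List A → (A → ℕ) → ℕ
  ∑ []      f = 0
  ∑ (x ∷ l) f = f x + ∑ l f

  ∑-mono : ∀ (l : List A) {f g : A → ℕ} → (∀ x → f x ≤ g x) → ∑ l f ≤ ∑ l g
  ∑-mono []      f≤g = z≤n
  ∑-mono (x ∷ l) f≤g = +-mono-≤ (f≤g x) (∑-mono l f≤g)

  ∑-cong : ∀ (l : List A) {f g : A → ℕ} → (∀ x → f x ≡ g x) → ∑ l f ≡ ∑ l g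
  ∑-cong []      f≡g = refl
  ∑-cong (x ∷ l) f≡g = cong₂ _+_ (f≡g x) (∑-cong l f≡g)

  ∑-const : ∀ (l : List A) k → ∑ l (λ _ → k) ≡ length l * k
  ∑-const []      k = refl
  ∑-const (x ∷ l) k = cong (k +_) (∑-const l k)

  length≡∑1 : ∀ (l : List A) → length l ≡ ∑ l (λ _ → 1)
  length≡∑1 l = sym (trans (∑-const l 1) (*-identityʳ _))

  ∑-+ : ∀ (l : List A) (f g : A → ℕ) → ∑ l (λ x → f x + g x) ≡ ∑ l f + ∑ l g
  ∑-+ []      f g = refl
  ∑-+ (x ∷ l) f g = trans (cong (f x + g x +_) (∑-+ l f g)) (interchange (f x) (g x) _ _)
    where
    interchange : ∀ m n o p → (m + n) + (o + p) ≡ (m + o) + (n + p)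
    interchange = solve-∀

  ∑-*ˡ : ∀ (l : List A) k (f : A → ℕ) → ∑ l (λ x → k * f x) ≡ k * ∑ l f
  ∑-*ˡ []      k f = sym (*-zeroʳ k)
  ∑-*ˡ (x ∷ l) k f = trans (cong (k * f x +_) (∑-*ˡ l k f)) (sym (*-distribˡ-+ k (f x) _))

  ∑-*ʳ : ∀ (l : List A) k (f : A → ℕ) → ∑ l (λ x → f x * k) ≡ ∑ l f * k
  ∑-*ʳ l k f = trans (∑-cong l λ x → *-comm (f x) k) (trans (∑-*ˡ l k f) (*-comm k _))

  ∑-++ : ∀ (l₁ l₂ : List A) (f : A → ℕ) → ∑ (l₁ ++ l₂) f ≡ ∑ l₁ f + ∑ l₂ f
  ∑-++ []       l₂ f = refl
  ∑-++ (x ∷ l₁) l₂ f = trans (cong (f x +_) (∑-++ l₁ l₂ f)) (sym (+-assoc (f x) _ _))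

  ∑-map : ∀ (g : A → B) (l : List A) (f : B → ℕ) → ∑ (map g l) f ≡ ∑ l (f ∘ g)
  ∑-map g []      f = refl
  ∑-map g (x ∷ l) f = cong (f (g x) +_) (∑-map g l f)

  ∑-comm : ∀ (l : List A) (l′ : List B) (f : A → B → ℕ) →
           ∑ l (λ x → ∑ l′ (f x)) ≡ ∑ l′ (λ y → ∑ l (λ x → f x y))
  ∑-comm []      l′ f = sym (trans (∑-const l′ 0) (*-zeroʳ (length l′)))
  ∑-comm (x ∷ l) l′ f = trans (cong (∑ l′ (f x) +_) (∑-comm l l′ f)) (sym (∑-+ l′ (f x) _))

  ∑-tabulate : ∀ {n} (g : Fin n → A) (f : A → ℕ) → ∑ (tabulate g) f ≡ ∑ (allFin n) (f ∘ g)
  ∑-tabulate {n = zero}  g f = refl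
  ∑-tabulate {n = suc n} g f = cong (f (g zero) +_)
    (trans (∑-tabulate (g ∘ suc) f) (sym (∑-tabulate suc (f ∘ g))))

  ∑-allFin-suc : ∀ {n} (f : Fin (suc n) → ℕ) → ∑ (allFin (suc n)) f ≡ f zero + ∑ (allFin n) (f ∘ suc)
  ∑-allFin-suc f = cong (f zero +_) (∑-tabulate suc f)

  term≤∑ : ∀ {n} (f : Fin n → ℕ) i → f i ≤ ∑ (allFin n) f
  term≤∑ {suc n} f i rewrite ∑-allFin-suc f with i
  ... | zero  = m≤m+n _ _
  ... | suc i = ≤-trans (term≤∑ (f ∘ suc) i) (m≤n+m _ (f zero))

  ∑-allFin-0 : ∀ {n} (f : Fin n → ℕ) → (∀ i → f i ≡ 0) → ∑ (allFin n) f ≡ 0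
  ∑-allFin-0 {n} f f≡0 = trans (∑-cong (allFin n) f≡0) (trans (∑-const (allFin n) 0) (*-zeroʳ (length (allFin n))))

  ∑-support : ∀ {n} (f : Fin n → ℕ) i → (∀ j → j ≢ i → f j ≡ 0) → ∑ (allFin n) f ≡ f i
  ∑-support {suc n} f zero    f≡0 = trans (∑-allFin-suc f)
    (trans (cong (f zero +_) (∑-allFin-0 (f ∘ suc) λ j → f≡0 (suc j) λ ())) (+-identityʳ _))
  ∑-support {suc n} f (suc i) f≡0 = trans (∑-allFin-suc f)
    (trans (cong (_+ ∑ (allFin n) (f ∘ suc)) (f≡0 zero λ ()))
      (∑-support (f ∘ suc) i λ j j≢i → f≡0 (suc j) λ { refl → j≢i refl }))

  -- The uniform probability space of `n` independent draws from `l`. Expectations appear as sums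
  -- over this list, with the denominators multiplied out.
  tuples : ∀ n → List A → List (Vec A n)
  tuples zero    l = [] ∷ []
  tuples (suc n) l = cartesianProductWith _∷_ l (tuples n l)

  ∑-cartesian : ∀ (h : A → B → C) (l : List A) (l′ : List B) (f : C → ℕ) →
                ∑ (cartesianProductWith h l l′) f ≡ ∑ l (λ x → ∑ l′ (λ y → f (h x y)))
  ∑-cartesian h []      l′ f = refl
  ∑-cartesian h (x ∷ l) l′ f = trans (∑-++ (map (h x) l′) _ f)
    (cong₂ _+_ (∑-map (h x) l′ f) (∑-cartesian h l l′ f))

  ∑-tuples-suc : ∀ n (l : List A) (f : Vec A (suc n) → ℕ) →
                 ∑ (tuples (suc n) l) f ≡ ∑ l (λ x → ∑ (tuples n l) (λ v → f (x ∷ v)))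
  ∑-tuples-suc n l f = ∑-cartesian _∷_ l (tuples n l) f

  length-tuples : ∀ n (l : List A) → length (tuples n l) ≡ length l ^ n
  length-tuples zero    l = refl
  length-tuples (suc n) l = begin
    length (tuples (suc n) l)               ≡⟨ length≡∑1 (tuples (suc n) l) ⟩
    ∑ (tuples (suc n) l) (λ _ → 1)          ≡⟨ ∑-tuples-suc n l _ ⟩
    ∑ l (λ _ → ∑ (tuples n l) (λ _ → 1))    ≡⟨ ∑-const l _ ⟩
    length l * ∑ (tuples n l) (λ _ → 1)     ≡⟨ cong (length l *_) (length≡∑1 (tuples n l)) ⟨
    length l * length (tuples n l)          ≡⟨ cong (length l *_) (length-tuples n l) ⟩
    length l * length l ^ n                 ∎
    where open ≡-Reasoning

  -- Each coordinate of a uniform tuple is itself uniform: the other coordinates contribute a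
  -- constant factor.
  ∑-lookup : ∀ {n} (l : List A) (φ : A → ℕ) (i : Fin n) →
             length l * ∑ (tuples n l) (λ v → φ (Vec.lookup v i)) ≡ length l ^ n * ∑ l φ
  ∑-lookup {n = suc n} l φ zero = begin
    M * ∑ (tuples (suc n) l) (λ v → φ (Vec.lookup v zero)) ≡⟨ cong (M *_) (∑-tuples-suc n l _) ⟩
    M * ∑ l (λ x → ∑ (tuples n l) (λ _ → φ x))
      ≡⟨ cong (M *_) (∑-cong l λ x → trans (∑-const (tuples n l) (φ x)) (cong (_* φ x) (length-tuples n l))) ⟩
    M * ∑ l (λ x → M ^ n * φ x) ≡⟨ cong (M *_) (∑-*ˡ l (M ^ n) φ) ⟩
    M * (M ^ n * ∑ l φ) ≡⟨ *-assoc M _ _ ⟨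
    M * M ^ n * ∑ l φ ∎
    where
    open ≡-Reasoning
    M = length l
  ∑-lookup {n = suc n} l φ (suc i) = begin
    M * ∑ (tuples (suc n) l) (λ v → φ (Vec.lookup v (suc i))) ≡⟨ cong (M *_) (∑-tuples-suc n l _) ⟩
    M * ∑ l (λ x → ∑ (tuples n l) (λ v → φ (Vec.lookup v i))) ≡⟨ cong (M *_) (∑-const l _) ⟩
    M * (M * ∑ (tuples n l) (λ v → φ (Vec.lookup v i)))   ≡⟨ cong (M *_) (∑-lookup l φ i) ⟩
    M * (M ^ n * ∑ l φ) ≡⟨ *-assoc M _ _ ⟨
    M * M ^ n * ∑ l φ ∎
    where
    open ≡-Reasoning
    M = length l

  -- Pairwise independence: for distinct coordinates the expectation of the product factors into the
  -- product of expectations.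
  ∑-lookup₂ : ∀ {n} (l : List A) (φ ψ : A → ℕ) (i j : Fin n) → i ≢ j →
              length l * length l * ∑ (tuples n l) (λ v → φ (Vec.lookup v i) * ψ (Vec.lookup v j))
              ≡ length l ^ n * (∑ l φ * ∑ l ψ)
  ∑-lookup₂ {n = suc n} l φ ψ zero zero i≢j = ⊥-elim (i≢j refl)
  ∑-lookup₂ {n = suc n} l φ ψ zero (suc j) _ = begin
    M * M * ∑ (tuples (suc n) l) (λ v → φ (Vec.lookup v zero) * ψ (Vec.lookup v (suc j)))
      ≡⟨ cong (M * M *_) (∑-tuples-suc n l _) ⟩
    M * M * ∑ l (λ x → ∑ (tuples n l) (λ v → φ x * ψ (Vec.lookup v j)))
      ≡⟨ cong (M * M *_) (trans (∑-cong l λ x → ∑-*ˡ (tuples n l) (φ x) _) (∑-*ʳ l _ φ)) ⟩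
    M * M * (∑ l φ * ∑ (tuples n l) (λ v → ψ (Vec.lookup v j)))
      ≡⟨ shuffle M (∑ l φ) _ ⟩
    M * (∑ l φ * (M * ∑ (tuples n l) (λ v → ψ (Vec.lookup v j))))
      ≡⟨ cong (λ s → M * (∑ l φ * s)) (∑-lookup l ψ j) ⟩
    M * (∑ l φ * (M ^ n * ∑ l ψ)) ≡⟨ shuffle′ M (∑ l φ) (M ^ n) _ ⟩
    M * M ^ n * (∑ l φ * ∑ l ψ) ∎
    where
    open ≡-Reasoning
    M = length l
    shuffle : ∀ m s t → m * m * (s * t) ≡ m * (s * (m * t))
    shuffle = solve-∀
    shuffle′ : ∀ m s p t → m * (s * (p * t)) ≡ m * p * (s * t)
    shuffle′ = solve-∀
  ∑-lookup₂ {n = suc n} l φ ψ (suc i) zero i≢j = begin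
    M * M * ∑ (tuples (suc n) l) (λ v → φ (Vec.lookup v (suc i)) * ψ (Vec.lookup v zero))
      ≡⟨ cong (M * M *_) (∑-cong (tuples (suc n) l) λ v → *-comm (φ (Vec.lookup v (suc i))) _) ⟩
    M * M * ∑ (tuples (suc n) l) (λ v → ψ (Vec.lookup v zero) * φ (Vec.lookup v (suc i)))
      ≡⟨ ∑-lookup₂ l ψ φ zero (suc i) (i≢j ∘ sym) ⟩
    M ^ suc n * (∑ l ψ * ∑ l φ) ≡⟨ cong (M ^ suc n *_) (*-comm (∑ l ψ) _) ⟩
    M ^ suc n * (∑ l φ * ∑ l ψ) ∎
    where
    open ≡-Reasoning
    M = length l
  ∑-lookup₂ {n = suc n} l φ ψ (suc i) (suc j) i≢j = begin
    M * M * ∑ (tuples (suc n) l) (λ v → φ (Vec.lookup v (suc i)) * ψ (Vec.lookup v (suc j)))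
      ≡⟨ cong (M * M *_) (trans (∑-tuples-suc n l _) (∑-const l _)) ⟩
    M * M * (M * S) ≡⟨ shuffle M S ⟩
    M * (M * M * S) ≡⟨ cong (M *_) (∑-lookup₂ l φ ψ i j (i≢j ∘ cong suc)) ⟩
    M * (M ^ n * (∑ l φ * ∑ l ψ)) ≡⟨ *-assoc M _ _ ⟨
    M * M ^ n * (∑ l φ * ∑ l ψ) ∎
    where
    open ≡-Reasoning
    M = length l
    S = ∑ (tuples n l) (λ v → φ (Vec.lookup v i) * ψ (Vec.lookup v j))
    shuffle : ∀ m s → m * m * (m * s) ≡ m * (m * m * s)
    shuffle = solve-∀

  ⟨_⟩ : Bool → ℕ
  ⟨ true  ⟩ = 1
  ⟨ false ⟩ = 0

  ⟨⟩≤1 : ∀ b → ⟨ b ⟩ ≤ 1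
  ⟨⟩≤1 true  = ≤-refl
  ⟨⟩≤1 false = z≤n

  bitStrings : ∀ T → List (Vec Bool T)
  bitStrings T = tuples T (true ∷ false ∷ [])

  allTrue : ∀ {T} → ℕ → Vec Bool T → Bool
  allTrue zero    v       = true
  allTrue (suc t) []      = false
  allTrue (suc t) (b ∷ v) = b ∧ allTrue t v

  -- Each of the first `t` bits that is forced to be true halves the number of admissible strings,
  -- which gives probability 2⁻ᵗ.
  ∑-allTrue : ∀ {t T} → t ≤ T → 2 ^ t * ∑ (bitStrings T) (λ v → ⟨ allTrue t v ⟩) ≡ 2 ^ T
  ∑-allTrue {T = T} z≤n = trans (+-identityʳ _)
    (trans (∑-const (bitStrings T) 1) (trans (*-identityʳ _) (length-tuples T _)))
  ∑-allTrue {suc t} {suc T} (s≤s t≤T) = begin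
    2 * 2 ^ t * ∑ (bitStrings (suc T)) (λ v → ⟨ allTrue (suc t) v ⟩)
      ≡⟨ cong (2 * 2 ^ t *_) (∑-tuples-suc T _ _) ⟩
    2 * 2 ^ t * (∑ (bitStrings T) (λ v → ⟨ allTrue t v ⟩) + (∑ (bitStrings T) (λ _ → 0) + 0))
      ≡⟨ cong (λ z → 2 * 2 ^ t * (∑ (bitStrings T) (λ v → ⟨ allTrue t v ⟩) + z)) vanish ⟩
    2 * 2 ^ t * (∑ (bitStrings T) (λ v → ⟨ allTrue t v ⟩) + 0)
      ≡⟨ shuffle (2 ^ t) _ ⟩
    2 * (2 ^ t * ∑ (bitStrings T) (λ v → ⟨ allTrue t v ⟩))
      ≡⟨ cong (2 *_) (∑-allTrue t≤T) ⟩
    2 * 2 ^ T ∎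
    where
    open ≡-Reasoning
    vanish : ∑ (bitStrings T) (λ _ → 0) + 0 ≡ 0
    vanish = trans (+-identityʳ _) (trans (∑-const (bitStrings T) 0) (*-zeroʳ (length (bitStrings T))))
    shuffle : ∀ p s → 2 * p * (s + 0) ≡ 2 * (p * s)
    shuffle = solve-∀

  -- A random set of density 2⁻ᵗ.
  level : ∀ {n T} → ℕ → Vec (Vec Bool T) n → Fin n → Bool
  level t ω j = allTrue t (Vec.lookup ω j)

-- Iterated random steps, dyadic densities and isolation.

module RandomSampling where
  open FiniteSums
  open import Data.Nat.Base using (_+_; _*_; _^_; _∸_; _≤_; _<_)
  open import Data.Nat.Properties
  open ≡ hiding ([_])

  iterate : ∀ {Ω : Set} {R} → (Ω → A → A) → Vec Ω R → A → A
  iterate step []       i = i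
  iterate step (ω ∷ ωs) i = iterate step ωs (step ω i)

  module _ {Ω : Set} (l : List Ω) (step : Ω → A → A) (Φ : A → ℕ) (p q : ℕ)
           (contracts : ∀ i → p * ∑ l (λ ω → Φ (step ω i)) ≤ q * (length l * Φ i)) where

    -- The one-step bound holds from every state, so it applies conditionally on the first draw, and
    -- the factor `q / p` multiplies over independent rounds.
    iterate-contracts : ∀ R i → p ^ R * ∑ (tuples R l) (λ ωs → Φ (iterate step ωs i))
                                ≤ q ^ R * (length l ^ R * Φ i)
    iterate-contracts zero    i = ≤-reflexive (cong (_+ 0) (trans (+-identityʳ _) (sym (+-identityʳ _))))
    iterate-contracts (suc R) i = begin
      p * p ^ R * ∑ (tuples (suc R) l) (λ ωs → Φ (iterate step ωs i))
        ≡⟨ cong (p * p ^ R *_) (∑-tuples-suc R l _) ⟩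
      p * p ^ R * ∑ l (λ ω → S ω)
        ≡⟨ trans (*-assoc p _ _) (cong (p *_) (sym (∑-*ˡ l (p ^ R) S))) ⟩
      p * ∑ l (λ ω → p ^ R * S ω)
        ≤⟨ *-monoʳ-≤ p (∑-mono l λ ω → iterate-contracts R (step ω i)) ⟩
      p * ∑ l (λ ω → q ^ R * (length l ^ R * Φ (step ω i)))
        ≡⟨ cong (p *_) (trans (∑-*ˡ l (q ^ R) _) (cong (q ^ R *_) (∑-*ˡ l (length l ^ R) _))) ⟩
      p * (q ^ R * (length l ^ R * ∑ l (λ ω → Φ (step ω i))))
        ≡⟨ pull p (q ^ R) (length l ^ R) _ ⟩
      q ^ R * length l ^ R * (p * ∑ l (λ ω → Φ (step ω i)))
        ≤⟨ *-monoʳ-≤ (q ^ R * length l ^ R) (contracts i) ⟩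
      q ^ R * length l ^ R * (q * (length l * Φ i))
        ≡⟨ push (q ^ R) (length l ^ R) q (length l) (Φ i) ⟩
      q ^ suc R * (length l ^ suc R * Φ i) ∎
      where
      open ≤-Reasoning
      S = λ ω → ∑ (tuples R l) (λ ωs → Φ (iterate step ωs (step ω i)))
      pull : ∀ p u v s → p * (u * (v * s)) ≡ u * v * (p * s)
      pull = solve-∀
      push : ∀ u v q m f → u * v * (q * (m * f)) ≡ q * u * (m * v * f)
      push = solve-∀

  -- Selects a density 2⁻⁽ᵗ⁺¹⁾ between 1/(4γ) and 1/(2γ): small enough that collisions cost at most
  -- half of the gain, large enough that a fixed element is sampled with probability of order 1/γ.
  scale : ∀ b γ → 1 ≤ γ → γ < 2 ^ b → ∃ λ t → t < suc b × 2 * γ ≤ 2 ^ suc t × 2 ^ suc t ≤ 4 * γ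
  scale zero    (suc γ) 1≤γ (s≤s ())
  scale (suc b) γ 1≤γ γ<2^1+b with γ <? 2 ^ b
  ... | yes γ<2^b = let t , t<b , lo , hi = scale b γ 1≤γ γ<2^b in t , m<n⇒m<1+n t<b , lo , hi
  ... | no γ≮2^b = suc b , ≤-refl , *-monoʳ-≤ 2 (<⇒≤ γ<2^1+b) ,
    ≤-trans (≤-reflexive (quadruple (2 ^ b))) (*-monoʳ-≤ 4 (≮⇒≥ γ≮2^b))
    where
    quadruple : ∀ s → 2 * (2 * s) ≡ 4 * s
    quadruple = solve-∀

  module _ {n : ℕ} (_≺_ : Fin n → Fin n → Bool) where

    rank : Fin n → ℕ
    rank i = ∑ (allFin n) λ j → ⟨ i ≺ j ⟩

    Isolates : Fin n → (Fin n → Bool) → Fin n → Set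
    Isolates i R g = i ≺ g ≡ true × R g ≡ true × (∀ j → j ≢ g → R j ≡ true → i ≺ j ≡ false)

    isolates? : ∀ i R g → Dec (Isolates i R g)
    isolates? i R g = (i ≺ g Bool.≟ true) ×-dec (R g Bool.≟ true) ×-dec
      Fin.all? λ j → ¬? (j Fin.≟ g) →-dec (R j Bool.≟ true) →-dec (i ≺ j Bool.≟ false)

  -- Expected decrease of the rank in one round.

  module Contraction {n : ℕ} (_≺_ : Fin n → Fin n → Bool)
    (≺-asym : ∀ i j → i ≺ j ≡ true → j ≺ i ≡ false)
    (≺-trans : ∀ i j k → i ≺ j ≡ true → j ≺ k ≡ true → i ≺ k ≡ true)
    (i : Fin n) where

    private
      Φ = rank _≺_
      γ = Φ i
      u = λ g → ⟨ i ≺ g ⟩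
      gain = λ g → u g * (γ ∸ Φ g)
      total = ∑ (allFin n) gain

    rank-anti : ∀ g → i ≺ g ≡ true → Φ g ≤ γ
    rank-anti g i≺g = ∑-mono (allFin n) λ h → below h
      where
      below : ∀ h → ⟨ g ≺ h ⟩ ≤ ⟨ i ≺ h ⟩
      below h with g ≺ h in g≺h
      ... | false = z≤n
      ... | true rewrite ≺-trans i g h i≺g g≺h = ≤-refl

    -- By transitivity the left side counts ordered pairs `g ≺ h` with both above `i`, and by
    -- asymmetry each pair is counted in at most one of its two orders.
    pairs≤ : 2 * ∑ (allFin n) (λ g → u g * Φ g) ≤ γ * γ
    pairs≤ = begin
      2 * ∑ (allFin n) (λ g → u g * Φ g)
        ≤⟨ *-monoʳ-≤ 2 (∑-mono (allFin n) λ g →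
             ≤-trans (≤-reflexive (sym (∑-*ˡ (allFin n) (u g) _))) (∑-mono (allFin n) (inside g))) ⟩
      2 * ∑ (allFin n) (λ g → ∑ (allFin n) (λ h → P g h))
        ≡⟨ cong (P² +_) (+-identityʳ P²) ⟩
      P² + P²
        ≡⟨ cong (P² +_) (∑-comm (allFin n) (allFin n) P) ⟩
      P² + ∑ (allFin n) (λ g → ∑ (allFin n) (λ h → P h g))
        ≡⟨ ∑-+ (allFin n) _ _ ⟨
      ∑ (allFin n) (λ g → ∑ (allFin n) (P g) + ∑ (allFin n) (λ h → P h g))
        ≡⟨ ∑-cong (allFin n) (λ g → ∑-+ (allFin n) _ _) ⟨
      ∑ (allFin n) (λ g → ∑ (allFin n) (λ h → P g h + P h g))
        ≤⟨ ∑-mono (allFin n) (λ g → ∑-mono (allFin n) (once g)) ⟩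
      ∑ (allFin n) (λ g → ∑ (allFin n) (λ h → u g * u h))
        ≡⟨ trans (∑-cong (allFin n) λ g → ∑-*ˡ (allFin n) (u g) u) (∑-*ʳ (allFin n) γ u) ⟩
      γ * γ ∎
      where
      open ≤-Reasoning
      P : Fin n → Fin n → ℕ
      P g h = u g * u h * ⟨ g ≺ h ⟩
      P² = ∑ (allFin n) (λ g → ∑ (allFin n) (λ h → P g h))
      inside : ∀ g h → u g * ⟨ g ≺ h ⟩ ≤ P g h
      inside g h with i ≺ g in i≺g
      ... | false = z≤n
      ... | true with g ≺ h in g≺h
      ...   | false = z≤n
      ...   | true rewrite ≺-trans i g h i≺g g≺h = ≤-refl
      once : ∀ g h → P g h + P h g ≤ u g * u h
      once g h with i ≺ g | i ≺ h
      ... | false | false = z≤n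
      ... | false | true  = z≤n
      ... | true  | false = z≤n
      ... | true  | true with g ≺ h in g≺h
      ...   | true rewrite ≺-asym g h g≺h = ≤-refl
      ...   | false with h ≺ g
      ...     | true  = ≤-refl
      ...     | false = z≤n

    -- Averaged over the γ elements above `i`, moving to one of them lowers the rank by at least
    -- γ/2; this is `pairs≤` subtracted from γ².
    total≥ : γ * γ ≤ 2 * total
    total≥ = +-cancelˡ-≤ (γ * γ) _ _ (begin
      γ * γ + γ * γ ≡⟨ cong₂ _+_ split split ⟩
      (total + Q) + (total + Q) ≡⟨ double total Q ⟩
      2 * Q + 2 * total ≤⟨ +-monoˡ-≤ (2 * total) pairs≤ ⟩
      γ * γ + 2 * total ∎)
      where
      open ≤-Reasoning
      Q = ∑ (allFin n) (λ g → u g * Φ g)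
      double : ∀ a q → (a + q) + (a + q) ≡ 2 * q + 2 * a
      double = solve-∀
      part : ∀ g → u g * γ ≡ gain g + u g * Φ g
      part g with i ≺ g in i≺g
      ... | false = refl
      ... | true = trans (cong (_+ 0) (sym (m∸n+n≡m (rank-anti g i≺g))))
        (distrib (γ ∸ Φ g) (Φ g))
        where
        distrib : ∀ d f → (d + f) + 0 ≡ (d + 0) + (f + 0)
        distrib = solve-∀
      split : γ * γ ≡ total + Q
      split = trans (sym (∑-*ʳ (allFin n) γ u)) (trans (∑-cong (allFin n) part) (∑-+ (allFin n) gain _))

    private
      distinct : Fin n → Fin n → ℕ
      distinct g h = ⟨ not (does (g Fin.≟ h)) ⟩

      -- The correction term for a collision: the gain of `g`, charged when a different `h` above
      -- `i` is sampled together with `g`.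
      pair : (Fin n → Bool) → Fin n → Fin n → ℕ
      pair R g h = gain g * (u h * distinct g h) * (⟨ R g ⟩ * ⟨ R h ⟩)

    -- Bonferroni: the indicator of "R isolates g" is at least
    -- [g ∈ R] − ∑_{h ≠ g} [g ∈ R][h ∈ R], which needs only pairwise independence.
    bonferroni : ∀ R s → Φ s ≤ γ → (∀ g → Isolates _≺_ i R g → Φ s ≤ Φ g) →
      Φ s + ∑ (allFin n) (λ g → gain g * ⟨ R g ⟩) ≤ γ + ∑ (allFin n) (λ g → ∑ (allFin n) (pair R g))
    bonferroni R s Φs≤γ Φs≤Φg with Fin.any? (isolates? _≺_ i R)
    ... | yes (g , iso@(i≺g , Rg , alone)) = begin
      Φ s + ∑ (allFin n) (λ g → gain g * ⟨ R g ⟩)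
        ≡⟨ cong (Φ s +_) (∑-support _ g elsewhere) ⟩
      Φ s + gain g * ⟨ R g ⟩
        ≡⟨ cong₂ (λ b c → Φ s + ⟨ b ⟩ * (γ ∸ Φ g) * ⟨ c ⟩) i≺g Rg ⟩
      Φ s + 1 * (γ ∸ Φ g) * 1 ≡⟨ cong (Φ s +_) (trans (*-identityʳ _) (*-identityˡ _)) ⟩
      Φ s + (γ ∸ Φ g) ≤⟨ +-monoˡ-≤ _ (Φs≤Φg g iso) ⟩
      Φ g + (γ ∸ Φ g) ≡⟨ m+[n∸m]≡n (rank-anti g i≺g) ⟩
      γ ≤⟨ m≤m+n γ _ ⟩
      γ + ∑ (allFin n) (λ g → ∑ (allFin n) (pair R g)) ∎
      where
      open ≤-Reasoning
      elsewhere : ∀ j → j ≢ g → gain j * ⟨ R j ⟩ ≡ 0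
      elsewhere j j≢g with R j in Rj
      ... | false = *-zeroʳ (gain j)
      ... | true rewrite alone j j≢g Rj = refl
    ... | no ¬iso = +-mono-≤ Φs≤γ (∑-mono (allFin n) term)
      where
      -- Without isolation, every sampled `g` above `i` has a second sampled `h` above `i`, and the
      -- single term `pair R g h` already equals the term to be bounded.
      term : ∀ g → gain g * ⟨ R g ⟩ ≤ ∑ (allFin n) (pair R g)
      term g with Fin.any? (λ h → ¬? (h Fin.≟ g) ×-dec (R h Bool.≟ true) ×-dec (i ≺ h Bool.≟ true))
      ... | yes (h , h≢g , Rh , i≺h) = ≤-trans (≤-reflexive (sym eq)) (term≤∑ (pair R g) h)
        where
        eq : pair R g h ≡ gain g * ⟨ R g ⟩
        eq rewrite Rh | i≺h | dec-false (g Fin.≟ h) (h≢g ∘ sym) =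
          cong₂ _*_ (*-identityʳ (gain g)) (*-identityʳ ⟨ R g ⟩)
      ... | no none with i ≺ g in i≺g | R g in Rg
      ...   | false | _     = z≤n
      ...   | true  | false = ≤-trans (≤-reflexive (*-zeroʳ (1 * (γ ∸ Φ g)))) z≤n
      ...   | true  | true  = ⊥-elim (¬iso (g , i≺g , Rg , λ j j≢g Rj → Bool.¬-not λ i≺j → none (j , j≢g , Rj , i≺j)))

    module _ {T : ℕ} where
      Ω = tuples n (bitStrings T)
      N = length Ω

      private
        M = length (bitStrings T)

        M≡2^T : M ≡ 2 ^ T
        M≡2^T = length-tuples T _

        M≢0 : NonZero M
        M≢0 = subst NonZero (sym M≡2^T) (m^n≢0 2 T)

        N≡M^n : N ≡ M ^ n
        N≡M^n = length-tuples n _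

      -- The rows of ω are independent uniform bit strings, so `∑-lookup` reduces the claim to one
      -- row; the factor `M` it introduces is cancelled.
      ∑-level : ∀ {t} → t ≤ T → ∀ g → 2 ^ t * ∑ Ω (λ ω → ⟨ level t ω g ⟩) ≡ N
      ∑-level {t} t≤T g = *-cancelˡ-≡ _ _ M {{M≢0}} (begin
        M * (2 ^ t * ∑ Ω (λ ω → ⟨ level t ω g ⟩)) ≡⟨ swap M (2 ^ t) _ ⟩
        2 ^ t * (M * ∑ Ω (λ ω → ⟨ level t ω g ⟩)) ≡⟨ cong (2 ^ t *_) (∑-lookup (bitStrings T) _ g) ⟩
        2 ^ t * (M ^ n * ∑ (bitStrings T) (λ v → ⟨ allTrue t v ⟩)) ≡⟨ swap (2 ^ t) (M ^ n) _ ⟩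
        M ^ n * (2 ^ t * ∑ (bitStrings T) (λ v → ⟨ allTrue t v ⟩))
          ≡⟨ cong₂ _*_ (sym N≡M^n) (trans (∑-allTrue t≤T) (sym M≡2^T)) ⟩
        N * M ≡⟨ *-comm N M ⟩
        M * N ∎)
        where
        open ≡-Reasoning
        swap : ∀ a b c → a * (b * c) ≡ b * (a * c)
        swap = solve-∀

      -- Two distinct indices read different rows of ω, so their memberships are independent and the
      -- probabilities 2⁻ᵗ multiply.
      ∑-level₂ : ∀ {t} → t ≤ T → ∀ g h → g ≢ h →
        2 ^ t * 2 ^ t * ∑ Ω (λ ω → ⟨ level t ω g ⟩ * ⟨ level t ω h ⟩) ≡ N
      ∑-level₂ {t} t≤T g h g≢h = *-cancelˡ-≡ _ _ (M * M) {{m*n≢0 M M {{M≢0}} {{M≢0}}}} (begin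
        M * M * (m * m * ∑ Ω (λ ω → ⟨ level t ω g ⟩ * ⟨ level t ω h ⟩)) ≡⟨ swap (M * M) (m * m) _ ⟩
        m * m * (M * M * ∑ Ω (λ ω → ⟨ level t ω g ⟩ * ⟨ level t ω h ⟩))
          ≡⟨ cong (m * m *_) (∑-lookup₂ (bitStrings T) _ _ g h g≢h) ⟩
        m * m * (M ^ n * (q * q)) ≡⟨ regroup m (M ^ n) q ⟩
        M ^ n * ((m * q) * (m * q)) ≡⟨ cong₂ (λ a b → a * (b * b)) (sym N≡M^n) (trans (∑-allTrue t≤T) (sym M≡2^T)) ⟩
        N * (M * M) ≡⟨ *-comm N _ ⟩
        M * M * N ∎)
        where
        open ≡-Reasoning
        m = 2 ^ t
        q = ∑ (bitStrings T) (λ v → ⟨ allTrue t v ⟩)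
        swap : ∀ a b c → a * (b * c) ≡ b * (a * c)
        swap = solve-∀
        regroup : ∀ m p q → m * m * (p * (q * q)) ≡ p * ((m * q) * (m * q))
        regroup = solve-∀

      module _ (step : Vec (Vec Bool T) n → Fin n)
               (step-rank : ∀ ω → Φ (step ω) ≤ γ)
               (step-isolates : ∀ ω t g → t < T → Isolates _≺_ i (level (suc t) ω) g → Φ (step ω) ≤ Φ g) where

        private
          S = ∑ Ω (λ ω → Φ (step ω))

          -- The Bonferroni bound summed over ω and multiplied by m². In expectation it reads: new
          -- rank ≤ γ - total/m + total·γ/m², where 1/m is the density.
          summed : ∀ t → t < T → let m = 2 ^ suc t in
            m * m * S + m * (N * total) ≤ m * m * (N * γ) + total * (γ * N)
          summed t t<T = begin
            m * m * S + m * (N * total)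
              ≡⟨ cong (λ z → m * m * S + m * z) singles ⟨
            m * m * S + m * (m * ∑ Ω (λ ω → ∑ (allFin n) (λ g → gain g * ⟨ ρ ω g ⟩)))
              ≡⟨ factor m S _ ⟩
            m * m * (S + ∑ Ω (λ ω → ∑ (allFin n) (λ g → gain g * ⟨ ρ ω g ⟩)))
              ≡⟨ cong (m * m *_) (∑-+ Ω _ _) ⟨
            m * m * ∑ Ω (λ ω → Φ (step ω) + ∑ (allFin n) (λ g → gain g * ⟨ ρ ω g ⟩))
              ≤⟨ *-monoʳ-≤ (m * m) (∑-mono Ω λ ω → bonferroni (ρ ω) (step ω) (step-rank ω) λ g → step-isolates ω t g t<T) ⟩
            m * m * ∑ Ω (λ ω → γ + ∑ (allFin n) (λ g → ∑ (allFin n) (pair (ρ ω) g)))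
              ≡⟨ cong (m * m *_) (∑-+ Ω _ _) ⟩
            m * m * (∑ Ω (λ _ → γ) + ∑ Ω (λ ω → ∑ (allFin n) (λ g → ∑ (allFin n) (pair (ρ ω) g))))
              ≡⟨ *-distribˡ-+ (m * m) _ _ ⟩
            m * m * ∑ Ω (λ _ → γ) + m * m * ∑ Ω (λ ω → ∑ (allFin n) (λ g → ∑ (allFin n) (pair (ρ ω) g)))
              ≡⟨ cong₂ (λ y z → m * m * y + m * m * z) (∑-const Ω γ)
                   (trans (∑-comm Ω (allFin n) _) (∑-cong (allFin n) λ g → ∑-comm Ω (allFin n) _)) ⟩
            m * m * (N * γ) + m * m * ∑ (allFin n) (λ g → ∑ (allFin n) (λ h → ∑ Ω (λ ω → pair (ρ ω) g h)))
              ≡⟨ cong (m * m * (N * γ) +_)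
                   (trans (sym (∑-*ˡ (allFin n) (m * m) _)) (∑-cong (allFin n) λ g → sym (∑-*ˡ (allFin n) (m * m) _))) ⟩
            m * m * (N * γ) + ∑ (allFin n) (λ g → ∑ (allFin n) (λ h → m * m * ∑ Ω (λ ω → pair (ρ ω) g h)))
              ≤⟨ +-monoʳ-≤ (m * m * (N * γ)) (∑-mono (allFin n) λ g → ∑-mono (allFin n) λ h → doubles g h) ⟩
            m * m * (N * γ) + ∑ (allFin n) (λ g → ∑ (allFin n) (λ h → gain g * (u h * N)))
              ≡⟨ cong (m * m * (N * γ) +_)
                   (trans (∑-cong (allFin n) λ g → trans (∑-*ˡ (allFin n) (gain g) _) (cong (gain g *_) (∑-*ʳ (allFin n) N u)))
                     (∑-*ʳ (allFin n) (γ * N) gain)) ⟩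
            m * m * (N * γ) + total * (γ * N) ∎
            where
            open ≤-Reasoning
            m = 2 ^ suc t
            ρ = level (suc t)
            factor : ∀ k s r → k * k * s + k * (k * r) ≡ k * k * (s + r)
            factor = solve-∀
            swap : ∀ a b c → a * (b * c) ≡ b * (a * c)
            swap = solve-∀
            singles : m * ∑ Ω (λ ω → ∑ (allFin n) (λ g → gain g * ⟨ ρ ω g ⟩)) ≡ N * total
            singles = begin-equality
              m * ∑ Ω (λ ω → ∑ (allFin n) (λ g → gain g * ⟨ ρ ω g ⟩))
                ≡⟨ cong (m *_) (trans (∑-comm Ω (allFin n) _) (∑-cong (allFin n) λ g → ∑-*ˡ Ω (gain g) _)) ⟩
              m * ∑ (allFin n) (λ g → gain g * ∑ Ω (λ ω → ⟨ ρ ω g ⟩))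
                ≡⟨ ∑-*ˡ (allFin n) m _ ⟨
              ∑ (allFin n) (λ g → m * (gain g * ∑ Ω (λ ω → ⟨ ρ ω g ⟩)))
                ≡⟨ ∑-cong (allFin n) (λ g → trans (swap m (gain g) _) (cong (gain g *_) (∑-level t<T g))) ⟩
              ∑ (allFin n) (λ g → gain g * N)
                ≡⟨ ∑-*ʳ (allFin n) N gain ⟩
              total * N ≡⟨ *-comm total N ⟩
              N * total ∎
            doubles : ∀ g h → m * m * ∑ Ω (λ ω → pair (ρ ω) g h) ≤ gain g * (u h * N)
            doubles g h = begin
              m * m * ∑ Ω (λ ω → pair (ρ ω) g h)
                ≡⟨ cong (m * m *_) (∑-*ˡ Ω (gain g * (u h * distinct g h)) _) ⟩
              m * m * (gain g * (u h * distinct g h) * E)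
                ≡⟨ regroup m (gain g) (u h) (distinct g h) E ⟩
              gain g * (u h * (distinct g h * (m * m * E)))
                ≤⟨ *-monoʳ-≤ (gain g) (*-monoʳ-≤ (u h) bound) ⟩
              gain g * (u h * N) ∎
              where
              E = ∑ Ω (λ ω → ⟨ ρ ω g ⟩ * ⟨ ρ ω h ⟩)
              regroup : ∀ m a b d e → m * m * (a * (b * d) * e) ≡ a * (b * (d * (m * m * e)))
              regroup = solve-∀
              bound : distinct g h * (m * m * E) ≤ N
              bound with g Fin.≟ h
              ... | yes _ = z≤n
              ... | no g≢h = ≤-reflexive (trans (*-identityˡ _) (∑-level₂ t<T g h g≢h))

          -- Since 2γ ≤ m, the collision term is at most half of the gain, leaving a decrease of
          -- a/(2m). With a ≥ γ²/2 and m ≤ 4γ this is at least γ/16, hence the factor 15/16.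
          finish : ∀ m s a → .{{_ : NonZero m}} → 2 * γ ≤ m → m ≤ 4 * γ → γ * γ ≤ 2 * a →
            m * m * s + m * (N * a) ≤ m * m * (N * γ) + a * (γ * N) → 16 * s ≤ 15 * (N * γ)
          finish m s a 2γ≤m m≤4γ γ²≤2a bound =
            *-cancelˡ-≤ m (+-cancelʳ-≤ (m * (N * γ)) _ _ (begin
            m * (16 * s) + m * (N * γ)         ≤⟨ +-monoʳ-≤ _ (*-monoˡ-≤ (N * γ) m≤4γ) ⟩
            m * (16 * s) + 4 * γ * (N * γ)     ≡⟨ e₄ m s γ N ⟩
            4 * (4 * m * s + N * (γ * γ))      ≤⟨ *-monoʳ-≤ 4 (+-monoʳ-≤ (4 * m * s) (*-monoʳ-≤ N γ²≤2a)) ⟩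
            4 * (4 * m * s + N * (2 * a))      ≡⟨ e₅ m s N a ⟩
            8 * (2 * m * s + N * a)            ≤⟨ *-monoʳ-≤ 8 once ⟩
            8 * (2 * m * (N * γ))              ≡⟨ e₆ m (N * γ) ⟩
            m * (15 * (N * γ)) + m * (N * γ)   ∎))
            where
            open ≤-Reasoning
            e₁ : ∀ m s n a → m * (2 * m * s + n * a) + m * (n * a) ≡ 2 * (m * m * s + m * (n * a))
            e₁ = solve-∀
            e₂ : ∀ m k a γ n → 2 * (m * m * k + a * (γ * n)) ≡ 2 * (m * m * k) + 2 * γ * (n * a)
            e₂ = solve-∀
            e₃ : ∀ m k r → 2 * (m * m * k) + r ≡ m * (2 * m * k) + r
            e₃ = solve-∀
            e₄ : ∀ m s γ n → m * (16 * s) + 4 * γ * (n * γ) ≡ 4 * (4 * m * s + n * (γ * γ))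
            e₄ = solve-∀
            e₅ : ∀ m s n a → 4 * (4 * m * s + n * (2 * a)) ≡ 8 * (2 * m * s + n * a)
            e₅ = solve-∀
            e₆ : ∀ m k → 8 * (2 * m * k) ≡ m * (15 * k) + m * k
            e₆ = solve-∀
            once : 2 * m * s + N * a ≤ 2 * m * (N * γ)
            once = *-cancelˡ-≤ m (+-cancelʳ-≤ (m * (N * a)) _ _ (begin
              m * (2 * m * s + N * a) + m * (N * a)   ≡⟨ e₁ m s N a ⟩
              2 * (m * m * s + m * (N * a))           ≤⟨ *-monoʳ-≤ 2 bound ⟩
              2 * (m * m * (N * γ) + a * (γ * N))     ≡⟨ e₂ m (N * γ) a γ N ⟩
              2 * (m * m * (N * γ)) + 2 * γ * (N * a) ≤⟨ +-monoʳ-≤ _ (*-monoˡ-≤ (N * a) 2γ≤m) ⟩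
              2 * (m * m * (N * γ)) + m * (N * a)     ≡⟨ e₃ m (N * γ) _ ⟩
              m * (2 * m * (N * γ)) + m * (N * a)     ∎))

        rank-contracts : ∀ b → suc b ≡ T → γ < 2 ^ b → 16 * S ≤ 15 * (N * γ)
        rank-contracts b refl γ<2^b with γ ≟ 0
        -- `scale` requires a positive rank; at rank 0 the step cannot increase the rank, so the sum
        -- vanishes.
        ... | yes γ≡ = ≤-reflexive (trans (cong (16 *_) S≡0) (sym (cong (15 *_) (trans (cong (N *_) γ≡) (*-zeroʳ N)))))
          where
          S≡0 : S ≡ 0
          S≡0 = n≤0⇒n≡0 (≤-trans (∑-mono Ω λ ω → subst (Φ (step ω) ≤_) γ≡ (step-rank ω))
            (≤-reflexive (trans (∑-const Ω 0) (*-zeroʳ N))))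
        ... | no γ≢0 =
          let t , t<T , lo , hi = scale b γ (n≢0⇒n>0 γ≢0) γ<2^b
          in finish (2 ^ suc t) S total {{m^n≢0 2 (suc t)}} lo hi total≥ (summed t t<T)

open FiniteSums
open RandomSampling

-- Signs of products and differences in an ordered field.

module Sign (ℝ : CompleteOrderedField ℓ) where
  open CompleteOrderedField ℝ hiding (zero)
  open RealPower ℝ using (+-monoʳ-<; *-monoˡ-<; x<y⇒0<y-x)
  open RingProperties ring using (-1*x≈-x; -‿distribˡ-*; -‿distribʳ-*; -‿involutive)

  ≤-<-trans : ∀ {u v w} → u ≤ v → v < w → u < w
  ≤-<-trans (inj₁ u<v) v<w = <-trans u<v v<w
  ≤-<-trans (inj₂ u≈v) v<w = <-respˡ (sym u≈v) v<w

  neg*pos : ∀ {x y} → x < 0# → 0# < y → x * y < 0#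
  neg*pos {y = y} x<0 0<y = <-respʳ (zeroˡ y) (*-monoˡ-< 0<y x<0)

  x<0⇒0<-x : ∀ {x} → x < 0# → 0# < - x
  x<0⇒0<-x {x} x<0 = <-respʳ (+-identityˡ (- x)) (x<y⇒0<y-x x<0)

  neg*neg : ∀ {x y} → x < 0# → y < 0# → 0# < x * y
  neg*neg {x} {y} x<0 y<0 = <-respʳ
    (trans (sym (-‿distribˡ-* x (- y))) (trans (-‿cong (sym (-‿distribʳ-* x y))) (-‿involutive (x * y))))
    (*-pos (x<0⇒0<-x x<0) (x<0⇒0<-x y<0))

  square-pos : ∀ {x} → x ≉ 0# → 0# < x * x
  square-pos {x} x≉0 with compare x 0#
  ... | tri< x<0 _ _ = neg*neg x<0 x<0
  ... | tri≈ _ x≈0 _ = ⊥-elim (x≉0 x≈0)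
  ... | tri> _ _ 0<x = *-pos 0<x 0<x

  pos+nonneg : ∀ {x y} → 0# < x → 0# ≤ y → 0# < x + y
  pos+nonneg {x} 0<x (inj₁ 0<y) = <-trans 0<x (<-respˡ (+-identityʳ x) (+-monoʳ-< x 0<y))
  pos+nonneg {x} 0<x (inj₂ 0≈y) = <-respʳ (trans (sym (+-identityʳ x)) (+-congˡ 0≈y)) 0<x

  -- The form that x − y takes as the value of a Polynomial.
  diff : Carrier → Carrier → Carrier
  diff x y = x + - 1# * y

  diff≈- : ∀ x y → diff x y ≈ x - y
  diff≈- x y = +-congˡ (-1*x≈-x y)

  diff-neg : ∀ {x y} → x < y → diff x y < 0#
  diff-neg {x} {y} x<y = <-respʳ (-‿inverseʳ y) (<-respˡ (sym (diff≈- x y)) (+-monoˡ-< (- y) x<y))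

  diff-zero : ∀ {x y} → x ≈ y → diff x y ≈ 0#
  diff-zero {x} {y} x≈y = trans (diff≈- x y) (trans (+-congʳ x≈y) (-‿inverseʳ y))

  diff-pos : ∀ {x y} → y < x → 0# < diff x y
  diff-pos {x} {y} y<x = <-respʳ (sym (diff≈- x y)) (x<y⇒0<y-x y<x)

  diff-neg⁻¹ : ∀ {x y} → diff x y < 0# → x < y
  diff-neg⁻¹ {x} {y} d<0 with compare x y
  ... | tri< x<y _ _ = x<y
  ... | tri≈ _ x≈y _ = ⊥-elim (<-irrefl (diff-zero x≈y) d<0)
  ... | tri> _ _ y<x = ⊥-elim (<-asym d<0 (diff-pos y<x))

-- Decision trees with composition, and their evaluation.

module Trees (ℝ : CompleteOrderedField ℓ) (n : ℕ) where
  open CompleteOrderedField ℝ hiding (zero)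
  open PolynomialDecisionTree ℝ

  -- The index d only bounds the depth from above.
  data DT (X : Set) : ℕ → Set ℓ where
    leaf : ∀ {d} → X → DT X d
    test : ∀ {d} → Polynomial n → (t< t≈ t> : DT X d) → DT X (suc d)

  -- The elementary symmetric polynomial of degree `k`, split by whether a monomial uses the first
  -- entry.
  esym : ∀ {m} → (Fin m → Polynomial n) → ℕ → Polynomial n
  esym z zero                 = con 1#
  esym {zero}  z (suc k)      = con 0#
  esym {suc m} z (suc k)      = z zero ⊗ esym (z ∘ suc) k ⊕ esym (z ∘ suc) (suc k)

  private
    variable
      X Y : Set
      d e : ℕ

  weaken : d ℕ.≤ e → DT X d → DT X e
  weaken d≤e       (leaf y)          = leaf y
  weaken (s≤s d≤e) (test p t< t≈ t>) = test p (weaken d≤e t<) (weaken d≤e t≈) (weaken d≤e t>)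

  infixl 1 _>>=_
  _>>=_ : DT X d → (X → DT Y e) → DT Y (d ℕ.+ e)
  _>>=_ {d = d} {e = e} (leaf y) f = weaken (ℕ.m≤n+m e d) (f y)
  test p t< t≈ t> >>= f            = test p (t< >>= f) (t≈ >>= f) (t> >>= f)

  toTree : DT (Fin n) d → Tree n
  toTree (leaf i)          = leaf i
  toTree (test p t< t≈ t>) = test p (toTree t<) (toTree t≈) (toTree t>)

  depth-toTree : (t : DT (Fin n) d) → depth (toTree t) ℕ.≤ d
  depth-toTree (leaf i)          = z≤n
  depth-toTree (test p t< t≈ t>) =
    s≤s (ℕ.⊔-lub (ℕ.⊔-lub (depth-toTree t<) (depth-toTree t≈)) (depth-toTree t>))

  module _ (x : Vector Carrier n) where

    run : DT X d → X
    run (leaf y) = y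
    run (test p t< t≈ t>) with compare (⟦ p ⟧ x) 0#
    ... | tri< _ _ _ = run t<
    ... | tri≈ _ _ _ = run t≈
    ... | tri> _ _ _ = run t>

    run-weaken : (d≤e : d ℕ.≤ e) (t : DT X d) → run (weaken d≤e t) ≡ run t
    run-weaken d≤e (leaf y) = ≡.refl
    run-weaken (s≤s d≤e) (test p t< t≈ t>) with compare (⟦ p ⟧ x) 0#
    ... | tri< _ _ _ = run-weaken d≤e t<
    ... | tri≈ _ _ _ = run-weaken d≤e t≈
    ... | tri> _ _ _ = run-weaken d≤e t>

    run->>= : (t : DT X d) (f : X → DT Y e) → run (t >>= f) ≡ run (f (run t))
    run->>= {d = d} {e = e} (leaf y) f = run-weaken (ℕ.m≤n+m e d) (f y)
    run->>= (test p t< t≈ t>) f with compare (⟦ p ⟧ x) 0#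
    ... | tri< _ _ _ = run->>= t< f
    ... | tri≈ _ _ _ = run->>= t≈ f
    ... | tri> _ _ _ = run->>= t> f

    output-toTree : (t : DT (Fin n) d) → output (toTree t) x ≡ run t
    output-toTree (leaf i) = ≡.refl
    output-toTree (test p t< t≈ t>) with compare (⟦ p ⟧ x) 0#
    ... | tri< _ _ _ = output-toTree t<
    ... | tri≈ _ _ _ = output-toTree t≈
    ... | tri> _ _ _ = output-toTree t>

    run-test-< : ∀ p {t< t≈ t> : DT X d} → ⟦ p ⟧ x < 0# → run (test p t< t≈ t>) ≡ run t<
    run-test-< p p<0 with compare (⟦ p ⟧ x) 0#
    ... | tri< _ _ _   = ≡.refl
    ... | tri≈ ¬p<0 _ _ = ⊥-elim (¬p<0 p<0)
    ... | tri> ¬p<0 _ _ = ⊥-elim (¬p<0 p<0)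

    run-test-≈ : ∀ p {t< t≈ t> : DT X d} → ⟦ p ⟧ x ≈ 0# → run (test p t< t≈ t>) ≡ run t≈
    run-test-≈ p p≈0 with compare (⟦ p ⟧ x) 0#
    ... | tri< _ ¬p≈0 _ = ⊥-elim (¬p≈0 p≈0)
    ... | tri≈ _ _ _   = ≡.refl
    ... | tri> _ ¬p≈0 _ = ⊥-elim (¬p≈0 p≈0)

    run-test-> : ∀ p {t< t≈ t> : DT X d} → 0# < ⟦ p ⟧ x → run (test p t< t≈ t>) ≡ run t>
    run-test-> p 0<p with compare (⟦ p ⟧ x) 0#
    ... | tri< _ _ ¬0<p = ⊥-elim (¬0<p 0<p)
    ... | tri≈ _ _ ¬0<p = ⊥-elim (¬0<p 0<p)
    ... | tri> _ _ _   = ≡.refl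

-- Signs of elementary symmetric polynomials.

module Elementary (ℝ : CompleteOrderedField ℓ) {n : ℕ} (x : Vector (CompleteOrderedField.Carrier ℝ) n) where
  open CompleteOrderedField ℝ hiding (zero)
  open PolynomialDecisionTree ℝ
  open Trees ℝ n using (esym)
  open Sign ℝ

  nonzero : Carrier → ℕ
  nonzero y with compare y 0#
  ... | tri< _ _ _ = 1
  ... | tri≈ _ _ _ = 0
  ... | tri> _ _ _ = 1

  nonzeros : ∀ {m} → (Fin m → Polynomial n) → ℕ
  nonzeros {zero}  z = 0
  nonzeros {suc m} z = nonzero (⟦ z zero ⟧ x) ℕ.+ nonzeros (z ∘ suc)

  nonzeros≤ : ∀ {m} (z : Fin m → Polynomial n) → nonzeros z ℕ.≤ m
  nonzeros≤ {zero}  z = z≤n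
  nonzeros≤ {suc m} z with compare (⟦ z zero ⟧ x) 0#
  ... | tri< _ _ _ = s≤s (nonzeros≤ (z ∘ suc))
  ... | tri≈ _ _ _ = ℕ.m≤n⇒m≤1+n (nonzeros≤ (z ∘ suc))
  ... | tri> _ _ _ = s≤s (nonzeros≤ (z ∘ suc))

  nonzero-cong : ∀ {y y′} → (y ≈ 0# → y′ ≈ 0#) → (y ≉ 0# → y′ ≉ 0#) → nonzero y ≡ nonzero y′
  nonzero-cong {y} {y′} f g with compare y 0# | compare y′ 0#
  ... | tri< _ _ _ | tri< _ _ _ = ≡.refl
  ... | tri< _ y≉0 _ | tri≈ _ y′≈0 _ = ⊥-elim (g y≉0 y′≈0)
  ... | tri< _ _ _ | tri> _ _ _ = ≡.refl
  ... | tri≈ _ y≈0 _ | tri< _ y′≉0 _ = ⊥-elim (y′≉0 (f y≈0))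
  ... | tri≈ _ _ _ | tri≈ _ _ _ = ≡.refl
  ... | tri≈ _ y≈0 _ | tri> _ y′≉0 _ = ⊥-elim (y′≉0 (f y≈0))
  ... | tri> _ _ _ | tri< _ _ _ = ≡.refl
  ... | tri> _ y≉0 _ | tri≈ _ y′≈0 _ = ⊥-elim (g y≉0 y′≈0)
  ... | tri> _ _ _ | tri> _ _ _ = ≡.refl

  nonzeros-cong : ∀ {m} {z z′ : Fin m → Polynomial n} →
    (∀ j → nonzero (⟦ z j ⟧ x) ≡ nonzero (⟦ z′ j ⟧ x)) → nonzeros z ≡ nonzeros z′
  nonzeros-cong {zero}  eq = ≡.refl
  nonzeros-cong {suc m} eq = ≡.cong₂ ℕ._+_ (eq zero) (nonzeros-cong (eq ∘ suc))

  zero-term : ∀ {y u v} → y ≈ 0# → y * u + v ≈ v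
  zero-term y≈0 = trans (+-congʳ (trans (*-congʳ y≈0) (zeroˡ _))) (+-identityˡ _)

  both-vanish : ∀ {y u v} → u ≈ 0# → v ≈ 0# → y * u + v ≈ 0#
  both-vanish u≈0 v≈0 = trans (+-cong (trans (*-congˡ u≈0) (zeroʳ _)) v≈0) (+-identityˡ 0#)

  esym-skip : ∀ {m} (z : Fin (suc m) → Polynomial n) k → ⟦ z zero ⟧ x ≈ 0# →
    ⟦ esym z k ⟧ x ≈ ⟦ esym (z ∘ suc) k ⟧ x
  esym-skip z zero    z₀≈0 = refl
  esym-skip z (suc k) z₀≈0 = zero-term z₀≈0

  -- A squarefree monomial with more factors than there are nonzero entries contains a zero factor.
  esym-vanishes : ∀ {m} (z : Fin m → Polynomial n) k → nonzeros z ℕ.< k → ⟦ esym z k ⟧ x ≈ 0#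
  esym-vanishes {zero}  z (suc k) _ = refl
  esym-vanishes {suc m} z (suc k) lt with compare (⟦ z zero ⟧ x) 0#
  ... | tri≈ _ z₀≈0 _ = trans (zero-term z₀≈0) (esym-vanishes (z ∘ suc) (suc k) lt)
  ... | tri< _ _ _ = both-vanish (esym-vanishes (z ∘ suc) k (ℕ.≤-pred lt)) (esym-vanishes (z ∘ suc) (suc k) (ℕ.<⇒≤ lt))
  ... | tri> _ _ _ = both-vanish (esym-vanishes (z ∘ suc) k (ℕ.≤-pred lt)) (esym-vanishes (z ∘ suc) (suc k) (ℕ.<⇒≤ lt))

  mutual
    -- No monomial is negative, and one made only of nonzero entries is positive. Nonnegativity is
    -- proved simultaneously because the monomials that skip a positive first entry may all vanish.
    esym-pos : ∀ {m} (z : Fin m → Polynomial n) k → (∀ j → 0# ≤ ⟦ z j ⟧ x) →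
      k ℕ.≤ nonzeros z → 0# < ⟦ esym z k ⟧ x
    esym-pos {m} z zero z≥0 _ = 0<1
    esym-pos {suc m} z (suc k) z≥0 le with compare (⟦ z zero ⟧ x) 0#
    ... | tri< z₀<0 _ _ = ⊥-elim (RealPower.<⇒≱ ℝ z₀<0 (z≥0 zero))
    ... | tri≈ _ z₀≈0 _ = <-respʳ (sym (zero-term z₀≈0)) (esym-pos (z ∘ suc) (suc k) (z≥0 ∘ suc) le)
    ... | tri> _ _ 0<z₀ = pos+nonneg (*-pos 0<z₀ (esym-pos (z ∘ suc) k (z≥0 ∘ suc) (ℕ.≤-pred le)))
                                     (esym-nonneg (z ∘ suc) (suc k) (z≥0 ∘ suc))

    esym-nonneg : ∀ {m} (z : Fin m → Polynomial n) k → (∀ j → 0# ≤ ⟦ z j ⟧ x) → 0# ≤ ⟦ esym z k ⟧ x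
    esym-nonneg z k z≥0 with k ℕ.≤? nonzeros z
    ... | yes k≤ = inj₁ (esym-pos z k z≥0 k≤)
    ... | no k≰  = inj₂ (sym (esym-vanishes z k (ℕ.≰⇒> k≰)))

  -- The top nonvanishing elementary symmetric polynomial is the product of the
  -- nonzero entries.
  esym-neg : ∀ {m} (z : Fin m → Polynomial n) g → ⟦ z g ⟧ x < 0# →
    (∀ j → j ≢ g → 0# ≤ ⟦ z j ⟧ x) → ⟦ esym z (nonzeros z) ⟧ x < 0#
  esym-neg {suc m} z zero z₀<0 z≥0 with compare (⟦ z zero ⟧ x) 0#
  ... | tri≈ _ z₀≈0 _ = ⊥-elim (<-irrefl z₀≈0 z₀<0)
  ... | tri> _ _ 0<z₀ = ⊥-elim (<-asym z₀<0 0<z₀)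
  -- The first entry is nonzero, so the degree exceeds the number of nonzero entries in the tail by
  -- one; the summand that skips the first entry vanishes and a single product remains.
  ... | tri< _ _ _ = <-respˡ
    (sym (trans (+-congˡ (esym-vanishes (z ∘ suc) _ ℕ.≤-refl)) (+-identityʳ _)))
    (neg*pos z₀<0 (esym-pos (z ∘ suc) _ (λ j → z≥0 (suc j) λ ()) ℕ.≤-refl))
  esym-neg {suc m} z (suc g) z<0 z≥0 with compare (⟦ z zero ⟧ x) 0#
  ... | tri< z₀<0 _ _ = ⊥-elim (RealPower.<⇒≱ ℝ z₀<0 (z≥0 zero λ ()))
  ... | tri≈ _ z₀≈0 _ = <-respˡ (sym (esym-skip z (nonzeros (z ∘ suc)) z₀≈0))
    (esym-neg (z ∘ suc) g z<0 λ j j≢g → z≥0 (suc j) (j≢g ∘ Fin.suc-injective))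
  ... | tri> _ _ 0<z₀ = <-respˡ
    (sym (trans (+-cong (*-comm _ _) (esym-vanishes (z ∘ suc) _ ℕ.≤-refl)) (+-identityʳ _)))
    (neg*pos (esym-neg (z ∘ suc) g z<0 λ j j≢g → z≥0 (suc j) (j≢g ∘ Fin.suc-injective)) 0<z₀)

-- The randomized algorithm as a decision tree.

module Algorithm (ℝ : CompleteOrderedField ℓ) (n : ℕ) where
  open CompleteOrderedField ℝ hiding (zero)
  open PolynomialDecisionTree ℝ
  open Trees ℝ n
  open Sign ℝ

  difference : Fin n → Fin n → Polynomial n
  difference i j = var i ⊕ con (- 1#) ⊗ var j

  -- Squaring outside `S` removes the sign but keeps the zeros, so the number of nonzero factors is
  -- the same for every `S`.
  factor : (Fin n → Bool) → Fin n → Fin n → Polynomial n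
  factor S i j = if S j then difference i j else difference i j ⊗ difference i j

  -- For k the number of entries different from xᵢ, the sign of this polynomial
  -- is the parity of the number of j ∈ S with xᵢ < xⱼ, even in the presence of ties.
  parity : (Fin n → Bool) → Fin n → ℕ → Polynomial n
  parity S i k = esym (factor S i) k

  ∅ : Fin n → Bool
  ∅ _ = false

  -- Binary search in the interval from `lo` of length 2ˢ. For the empty set all factors are
  -- squares, so the tested polynomial is zero exactly when its degree exceeds the number sought,
  -- and positive otherwise; the negative branch repeats `upper`.
  countDistinct : ∀ s → ℕ → Fin n → DT ℕ s
  countDistinct zero    lo i = leaf lo
  countDistinct (suc s) lo i = test (parity ∅ i (lo ℕ.+ 2 ℕ.^ s)) upper lower upper
    where
    lower = countDistinct s lo i
    upper = countDistinct s (lo ℕ.+ 2 ℕ.^ s) i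

  refine : ∀ {b} → (Fin n → Fin (suc b) → Fin 2) → (Fin n → Bool) → Fin 2 → Fin n → Bool
  refine c R β j = R j ∧ does (c j zero Fin.≟ β)

  -- The default `i` for an empty set is harmless: the candidate is only ever kept if it is at least
  -- as good as another one.
  choose : Fin n → (Fin n → Bool) → Fin n
  choose i R with Fin.any? (λ j → R j Bool.≟ true)
  ... | yes (j , _) = j
  ... | no _        = i

  -- Reads one binary digit of the isolated index per test. A negative sign means that the members
  -- with digit 1 include an odd number of indices above `i`; under isolation, that the isolated
  -- index has digit 1.
  locate : ∀ b → (Fin n → Fin b → Fin 2) → (Fin n → Bool) → Fin n → ℕ → DT (Fin n) b
  locate zero    c R i k = leaf (choose i R)
  locate (suc b) c R i k = test (parity (refine c R (suc zero)) i k)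
    (descend (suc zero)) (descend zero) (descend zero)
    where
    descend : Fin 2 → DT (Fin n) b
    descend β = locate b (λ j → c j ∘ suc) (refine c R β) i k

  better : Fin n → Fin n → DT (Fin n) 1
  better j j′ = test (difference j j′) (leaf j′) (leaf j) (leaf j)

  module _ {b T : ℕ} (c : Fin n → Fin b → Fin 2) where

    -- Tries the densities 1/2, ..., 2⁻ᵗ and keeps the best index found. Starting from `i` itself
    -- ensures that the result is never worse than `i`.
    sweep : ∀ t → Vec (Vec Bool T) n → Fin n → ℕ → DT (Fin n) (t ℕ.* (b ℕ.+ 1))
    sweep zero    ω i k = leaf i
    sweep (suc t) ω i k = weaken bound
      (locate b c (level (suc t) ω) i k >>= λ j → sweep t ω i k >>= better j)
      where
      bound : b ℕ.+ (t ℕ.* (b ℕ.+ 1) ℕ.+ 1) ℕ.≤ b ℕ.+ 1 ℕ.+ t ℕ.* (b ℕ.+ 1)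
      bound = ℕ.≤-reflexive (≡.trans (cong (b ℕ.+_) (ℕ.+-comm (t ℕ.* (b ℕ.+ 1)) 1)) (≡.sym (ℕ.+-assoc b 1 _)))

    roundDepth : ℕ
    roundDepth = b ℕ.+ T ℕ.* (b ℕ.+ 1)

    round : Vec (Vec Bool T) n → Fin n → DT (Fin n) roundDepth
    round ω i = countDistinct b 0 i >>= sweep T ω i

    rounds : ∀ {R} → Vec (Vec (Vec Bool T) n) R → Fin n → DT (Fin n) (R ℕ.* roundDepth)
    rounds []       i = leaf i
    rounds (ω ∷ ωs) i = round ω i >>= rounds ωs

  -- Correctness of the algorithm on a fixed input.

  module Correctness (x : Vector Carrier n) where
    open Elementary ℝ x
    open IsStrictTotalOrder isStrictTotalOrder using (_<?_)

    _≺_ : Fin n → Fin n → Bool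
    i ≺ j = does (x i <? x j)

    ≺⇒< : ∀ {i j} → i ≺ j ≡ true → x i < x j
    ≺⇒< {i} {j} i≺j with x i <? x j
    ≺⇒< {i} {j} _ | yes i<j = i<j

    <⇒≺ : ∀ {i j} → x i < x j → i ≺ j ≡ true
    <⇒≺ {i} {j} i<j = dec-true (x i <? x j) i<j

    ⊀⇒≮ : ∀ {i j} → i ≺ j ≡ false → ¬ x i < x j
    ⊀⇒≮ {i} {j} i⊀j i<j with ≡.trans (≡.sym i⊀j) (<⇒≺ i<j)
    ... | ()

    ≮⇒⊀ : ∀ {i j} → ¬ x i < x j → i ≺ j ≡ false
    ≮⇒⊀ {i} {j} i≮j = dec-false (x i <? x j) i≮j

    -- The number of `j` with `x j` different from `x i`, since a squared difference vanishes only
    -- at a tie.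
    distinct : Fin n → ℕ
    distinct i = nonzeros (factor ∅ i)

    ⊗-≉ : ∀ {y} → y ≉ 0# → y * y ≉ 0#
    ⊗-≉ y≉0 yy≈0 = <-irrefl (sym yy≈0) (square-pos y≉0)

    nonzeros-factor : ∀ S i → nonzeros (factor S i) ≡ distinct i
    nonzeros-factor S i = nonzeros-cong same
      where
      same : ∀ j → nonzero (⟦ factor S i j ⟧ x) ≡ nonzero (⟦ factor ∅ i j ⟧ x)
      same j with S j
      ... | true  = nonzero-cong (λ y≈0 → trans (*-congʳ y≈0) (zeroˡ _)) ⊗-≉
      ... | false = ≡.refl

    factor-nonneg : ∀ S i j → (S j ≡ true → ¬ x i < x j) → 0# ≤ ⟦ factor S i j ⟧ x
    factor-nonneg S i j notAbove with S j
    ... | true  = RealPower.≮⇒≥ ℝ λ d<0 → notAbove ≡.refl (diff-neg⁻¹ d<0)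
    ... | false with compare (diff (x i) (x j)) 0#
    ...   | tri< _ y≉0 _ = inj₁ (square-pos y≉0)
    ...   | tri≈ _ y≈0 _ = inj₂ (sym (trans (*-congʳ y≈0) (zeroˡ _)))
    ...   | tri> _ y≉0 _ = inj₁ (square-pos y≉0)

    factor-neg : ∀ S i j → S j ≡ true → x i < x j → ⟦ factor S i j ⟧ x < 0#
    factor-neg S i j Sj i<j rewrite Sj = diff-neg i<j

    -- At degree `distinct i` only the product of all nonzero factors survives, and the factor of
    -- `g` is its one negative factor: other members of `S` are not above `i`, and non-members
    -- contribute squares.
    parity-odd : ∀ S i g → S g ≡ true → x i < x g → (∀ j → j ≢ g → S j ≡ true → ¬ x i < x j) →
      ⟦ parity S i (distinct i) ⟧ x < 0#
    parity-odd S i g Sg i<g alone = subst (λ k → ⟦ parity S i k ⟧ x < 0#) (nonzeros-factor S i)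
      (esym-neg (factor S i) g (factor-neg S i g Sg i<g) λ j j≢g → factor-nonneg S i j (alone j j≢g))

    parity-even : ∀ S i → (∀ j → S j ≡ true → ¬ x i < x j) → 0# < ⟦ parity S i (distinct i) ⟧ x
    parity-even S i none = esym-pos (factor S i) (distinct i) (λ j → factor-nonneg S i j (none j))
      (ℕ.≤-reflexive (≡.sym (nonzeros-factor S i)))

    countDistinct-correct : ∀ s lo i → lo ℕ.≤ distinct i → distinct i ℕ.< lo ℕ.+ 2 ℕ.^ s →
      run x (countDistinct s lo i) ≡ distinct i
    countDistinct-correct zero lo i lo≤ <hi =
      ℕ.≤-antisym lo≤ (ℕ.≤-pred (subst (distinct i ℕ.<_) (ℕ.+-comm lo 1) <hi))
    countDistinct-correct (suc s) lo i lo≤ <hi with distinct i ℕ.<? lo ℕ.+ 2 ℕ.^ s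
    ... | yes <mid = ≡.trans
      (run-test-≈ x (parity ∅ i (lo ℕ.+ 2 ℕ.^ s)) (esym-vanishes (factor ∅ i) _ <mid))
      (countDistinct-correct s lo i lo≤ <mid)
    ... | no ≮mid = ≡.trans
      (run-test-> x (parity ∅ i (lo ℕ.+ 2 ℕ.^ s))
        (esym-pos (factor ∅ i) _ (λ j → factor-nonneg ∅ i j λ ()) (ℕ.≮⇒≥ ≮mid)))
      (countDistinct-correct s (lo ℕ.+ 2 ℕ.^ s) i (ℕ.≮⇒≥ ≮mid)
        (ℕ.<-≤-trans <hi (ℕ.≤-reflexive split)))
      where
      split : lo ℕ.+ 2 ℕ.^ suc s ≡ lo ℕ.+ 2 ℕ.^ s ℕ.+ 2 ℕ.^ s
      split = ≡.trans (cong (λ z → lo ℕ.+ (2 ℕ.^ s ℕ.+ z)) (ℕ.+-identityʳ _)) (≡.sym (ℕ.+-assoc lo _ _))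

    refine-⊆ : ∀ {b} (c : Fin n → Fin (suc b) → Fin 2) R β j → refine c R β j ≡ true →
      R j ≡ true × c j zero ≡ β
    refine-⊆ c R β j eq with R j | c j zero Fin.≟ β
    refine-⊆ c R β j eq | true | yes cj≡β = ≡.refl , cj≡β

    refine-∈ : ∀ {b} (c : Fin n → Fin (suc b) → Fin 2) R j → R j ≡ true → refine c R (c j zero) j ≡ true
    refine-∈ c R j Rj rewrite Rj = dec-true (c j zero Fin.≟ c j zero) ≡.refl

    -- Induction on the digits left. Injectivity is assumed only for members of `R`, relative to
    -- `g`, so it survives dropping a digit: members of the refined set already agree with `g` on
    -- that digit.
    locate-correct : ∀ b c R i g → Isolates _≺_ i R g →
      (∀ j → R j ≡ true → (∀ β → c j β ≡ c g β) → j ≡ g) →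
      run x (locate b c R i (distinct i)) ≡ g
    locate-correct zero c R i g (_ , Rg , _) injective with Fin.any? (λ j → R j Bool.≟ true)
    ... | yes (j , Rj) = injective j Rj λ ()
    ... | no none      = ⊥-elim (none (g , Rg))
    locate-correct (suc b) c R i g (i≺g , Rg , alone) injective = go (c g zero) ≡.refl
      where
      descend : ∀ β → c g zero ≡ β →
        run x (locate b (λ j → c j ∘ suc) (refine c R β) i (distinct i)) ≡ g
      descend β ≡.refl = locate-correct b (λ j → c j ∘ suc) (refine c R β) i g
        (i≺g , refine-∈ c R g Rg , λ j j≢g R′j → alone j j≢g (proj₁ (refine-⊆ c R β j R′j)))
        λ j R′j same → let Rj , cj = refine-⊆ c R β j R′j in
          injective j Rj λ { zero → cj ; (suc δ) → same δ }

      go : ∀ β → c g zero ≡ β → run x (locate (suc b) c R i (distinct i)) ≡ g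
      go zero cg≡0 = ≡.trans
        (run-test-> x (parity (refine c R (suc zero)) i (distinct i))
          (parity-even _ i λ j R′j → none j (refine-⊆ c R _ j R′j)))
        (descend zero cg≡0)
        where
        -- The only member of `R` above `i` is `g`, whose digit is 0, so no member with digit 1 lies
        -- above `i`.
        none : ∀ j → R j ≡ true × c j zero ≡ suc zero → ¬ x i < x j
        none j (Rj , cj≡1) with j Fin.≟ g
        ... | no j≢g = ⊀⇒≮ (alone j j≢g Rj)
        ... | yes ≡.refl with ≡.trans (≡.sym cg≡0) cj≡1
        ...   | ()
      go (suc zero) cg≡1 = ≡.trans
        (run-test-< x (parity (refine c R (suc zero)) i (distinct i))
          (parity-odd _ i g
          (subst (λ β → refine c R β g ≡ true) cg≡1 (refine-∈ c R g Rg)) (≺⇒< i≺g)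
          λ j j≢g R′j → ⊀⇒≮ (alone j j≢g (proj₁ (refine-⊆ c R _ j R′j)))))
        (descend (suc zero) cg≡1)

    Φ : Fin n → ℕ
    Φ = rank _≺_

    Φ-anti : ∀ {i j} → x i ≤ x j → Φ j ℕ.≤ Φ i
    Φ-anti {i} {j} i≤j = ∑-mono (allFin n) below
      where
      below : ∀ h → ⟨ j ≺ h ⟩ ℕ.≤ ⟨ i ≺ h ⟩
      below h with j ≺ h in j≺h
      ... | false = z≤n
      ... | true rewrite <⇒≺ {i} {h} (≤-<-trans i≤j (≺⇒< j≺h)) = ℕ.≤-refl

    Φ≤n : ∀ i → Φ i ℕ.≤ n
    Φ≤n i = ℕ.≤-trans (∑-mono (allFin n) λ j → ⟨⟩≤1 (i ≺ j))
      (ℕ.≤-reflexive (≡.trans (≡.sym (length≡∑1 (allFin n))) (length-tabulate id)))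

    Φ≡0⇒maximum : ∀ {i} → Φ i ≡ 0 → IsMaximum x i
    Φ≡0⇒maximum {i} Φ≡0 j with x j ≤? x i
    ... | yes j≤i = j≤i
    ... | no j≰i = ⊥-elim (ℕ.<⇒≱ {0} {1} (s≤s z≤n)
      (ℕ.≤-trans (ℕ.≤-reflexive (cong ⟨_⟩ (≡.sym (<⇒≺ i<j)))) (ℕ.≤-trans (term≤∑ (λ h → ⟨ i ≺ h ⟩) j) (ℕ.≤-reflexive Φ≡0))))
      where
      i<j : x i < x j
      i<j with compare (x i) (x j)
      ... | tri< i<j _ _ = i<j
      ... | tri≈ _ i≈j _ = ⊥-elim (j≰i (inj₂ (sym i≈j)))
      ... | tri> _ _ j<i = ⊥-elim (j≰i (inj₁ j<i))

    -- The larger of two values has the smaller rank, so the winner is at least as good as both; at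
    -- a tie the ranks agree.
    better-Φ : ∀ j j′ → Φ (run x (better j j′)) ℕ.≤ Φ j × Φ (run x (better j j′)) ℕ.≤ Φ j′
    better-Φ j j′ with compare (⟦ difference j j′ ⟧ x) 0#
    ... | tri< d<0 _ _ = Φ-anti (inj₁ (diff-neg⁻¹ d<0)) , ℕ.≤-refl
    ... | tri≈ d≮0 _ _ = ℕ.≤-refl , Φ-anti (RealPower.≮⇒≥ ℝ (d≮0 ∘ diff-neg))
    ... | tri> d≮0 _ _ = ℕ.≤-refl , Φ-anti (RealPower.≮⇒≥ ℝ (d≮0 ∘ diff-neg))

    module _ {b T : ℕ} (c : Fin n → Fin b → Fin 2)
             (c-injective : ∀ i j → (∀ β → c i β ≡ c j β) → i ≡ j) where

      run-sweep : ∀ t (ω : Vec (Vec Bool T) n) i k → run x (sweep c (suc t) ω i k) ≡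
        run x (better (run x (locate b c (level (suc t) ω) i k)) (run x (sweep c t ω i k)))
      run-sweep t ω i k = ≡.trans (run-weaken x _ (locate b c (level (suc t) ω) i k >>= rest))
        (≡.trans (run->>= x (locate b c (level (suc t) ω) i k) rest)
          (run->>= x (sweep c t ω i k) (better (run x (locate b c (level (suc t) ω) i k)))))
        where
        rest : Fin n → DT (Fin n) (t ℕ.* (b ℕ.+ 1) ℕ.+ 1)
        rest j = sweep c t ω i k >>= better j

      sweep-Φ : ∀ t (ω : Vec (Vec Bool T) n) i k → Φ (run x (sweep c t ω i k)) ℕ.≤ Φ i
      sweep-Φ zero    ω i k = ℕ.≤-refl
      sweep-Φ (suc t) ω i k = ℕ.≤-trans (ℕ.≤-reflexive (cong Φ (run-sweep t ω i k)))
        (ℕ.≤-trans (proj₂ (better-Φ _ _)) (sweep-Φ t ω i k))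

      -- The isolated index is found at its own density, and every later comparison can only lower
      -- the rank.
      sweep-isolates : ∀ t (ω : Vec (Vec Bool T) n) i s g → s ℕ.< t → Isolates _≺_ i (level (suc s) ω) g →
        Φ (run x (sweep c t ω i (distinct i))) ℕ.≤ Φ g
      sweep-isolates (suc t) ω i s g s<t iso with s ℕ.≟ t
      ... | yes ≡.refl = ℕ.≤-trans (ℕ.≤-reflexive (cong Φ (run-sweep t ω i _)))
        (ℕ.≤-trans (proj₁ (better-Φ _ _)) (ℕ.≤-reflexive (cong Φ
          (locate-correct b c (level (suc t) ω) i g iso λ j _ → c-injective j g))))
      ... | no s≢t = ℕ.≤-trans (ℕ.≤-reflexive (cong Φ (run-sweep t ω i _)))
        (ℕ.≤-trans (proj₂ (better-Φ _ _)) (sweep-isolates t ω i s g (ℕ.≤∧≢⇒< (ℕ.≤-pred s<t) s≢t) iso))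

      step : Vec (Vec Bool T) n → Fin n → Fin n
      step ω i = run x (round c ω i)

      -- The bound serves twice: it puts the number of distinct entries in the range of the binary
      -- search, and it lets the densities reach the scale of every rank.
      module _ (n<2^b : n ℕ.< 2 ℕ.^ b) where

        step≡sweep : ∀ ω i → step ω i ≡ run x (sweep c T ω i (distinct i))
        step≡sweep ω i = ≡.trans (run->>= x (countDistinct b 0 i) _)
          (cong (λ k → run x (sweep c T ω i k))
            (countDistinct-correct b 0 i z≤n (ℕ.≤-<-trans (nonzeros≤ (factor ∅ i)) n<2^b)))

        step-contracts : suc b ≡ T → ∀ i →
          16 ℕ.* ∑ (tuples n (bitStrings T)) (λ ω → Φ (step ω i)) ℕ.≤ 15 ℕ.* (length (tuples n (bitStrings T)) ℕ.* Φ i)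
        step-contracts b+1≡T i = Contraction.rank-contracts _≺_
          (λ j k j≺k → ≮⇒⊀ (<-asym (≺⇒< j≺k)))
          (λ j k h j≺k k≺h → <⇒≺ (<-trans (≺⇒< j≺k) (≺⇒< k≺h))) i
          (λ ω → step ω i)
          (λ ω → ℕ.≤-trans (ℕ.≤-reflexive (cong Φ (step≡sweep ω i))) (sweep-Φ T ω i (distinct i)))
          (λ ω t g t<T iso → ℕ.≤-trans (ℕ.≤-reflexive (cong Φ (step≡sweep ω i))) (sweep-isolates T ω i t g t<T iso))
          b b+1≡T (ℕ.≤-<-trans (Φ≤n i) n<2^b)

      run-rounds : ∀ {R} (ωs : Vec (Vec (Vec Bool T) n) R) i → run x (rounds c ωs i) ≡ iterate step ωs i
      run-rounds []       i = ≡.refl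
      run-rounds (ω ∷ ωs) i = ≡.trans (run->>= x (round c ω i) _) (run-rounds ωs _)

-- Binary codes of indices, the number of rounds and the depth bound.

funToFin-cong : ∀ {m n} {f g : Fin m → Fin n} → (∀ i → f i ≡ g i) → funToFin f ≡ funToFin g
funToFin-cong {zero}  f≗g = ≡.refl
funToFin-cong {suc m} f≗g = ≡.cong₂ combine (f≗g zero) (funToFin-cong (f≗g ∘ suc))

digits : ∀ {n} b → n ℕ.≤ 2 ℕ.^ b → Fin n → Fin b → Fin 2
digits b n≤2^b i = finToFun (inject≤ i n≤2^b)

-- `funToFin` recovers the number from its digits, and embedding into the larger range is injective.
digits-injective : ∀ {n} b (n≤2^b : n ℕ.≤ 2 ℕ.^ b) i j →
  (∀ β → digits b n≤2^b i β ≡ digits b n≤2^b j β) → i ≡ j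
digits-injective b n≤2^b i j eq = Fin.inject≤-injective n≤2^b n≤2^b i j (begin
  inject≤ i n≤2^b                     ≡⟨ Fin.funToFin-finToFin {b} {2} _ ⟨
  funToFin (digits b n≤2^b i)         ≡⟨ funToFin-cong eq ⟩
  funToFin (digits b n≤2^b j)         ≡⟨ Fin.funToFin-finToFin {b} {2} _ ⟩
  inject≤ j n≤2^b                     ∎)
  where open ≡.≡-Reasoning

n<2^[1+⌊log₂n⌋] : ∀ n → n ℕ.< 2 ℕ.^ suc ⌊log₂ n ⌋
n<2^[1+⌊log₂n⌋] n = ℕ.≰⇒> λ 2^[1+L]≤n → ℕ.<⇒≱ (ℕ.n<1+n ⌊log₂ n ⌋)
  (subst (ℕ._≤ ⌊log₂ n ⌋) (⌊log₂[2^n]⌋≡n (suc ⌊log₂ n ⌋)) (⌊log₂⌋-mono-≤ 2^[1+L]≤n))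

-- The exponent is twice the logarithm rather than the logarithm plus one, so that it is 0 at `n` =
-- 1, where the depth bound permits no test at all.
n≤2^2⌊log₂n⌋ : ∀ n → n ℕ.≤ 2 ℕ.^ (2 ℕ.* ⌊log₂ n ⌋)
n≤2^2⌊log₂n⌋ n with ⌊log₂ n ⌋ | n<2^[1+⌊log₂n⌋] n
... | zero  | s≤s n≤1 = n≤1
... | suc L | n<      = ℕ.≤-trans (ℕ.<⇒≤ n<)
  (ℕ.^-monoʳ-≤ 2 (s≤s (ℕ.≤-trans (ℕ.≤-reflexive (ℕ.+-comm 1 L)) (ℕ.+-monoʳ-≤ L (s≤s z≤n)))))

^-distribʳ-* : ∀ k m n → (m ℕ.* n) ℕ.^ k ≡ m ℕ.^ k ℕ.* n ℕ.^ k
^-distribʳ-* zero    m n = ≡.refl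
^-distribʳ-* (suc k) m n = ≡.trans (cong (m ℕ.* n ℕ.*_) (^-distribʳ-* k m n)) (ℕ.[m*n]*[o*p]≡[m*o]*[n*p] m n _ _)

-- Since (16/15)¹¹ ≥ 2, these rounds shrink Φ by a factor 2^(2L(k+1)) ≥ n^(k+1).
roundCount : ℕ → ℕ → ℕ
roundCount k L = 11 ℕ.* (2 ℕ.* L ℕ.* suc k)

decay : ∀ k n → let R = roundCount k ⌊log₂ n ⌋ in n ℕ.^ suc k ℕ.* 15 ℕ.^ R ℕ.≤ 16 ℕ.^ R
decay k n = begin
  n ^ suc k * 15 ^ (11 * E)          ≤⟨ ℕ.*-monoˡ-≤ (15 ^ (11 * E)) (ℕ.^-monoˡ-≤ (suc k) (n≤2^2⌊log₂n⌋ n)) ⟩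
  (2 ^ (2 * ⌊log₂ n ⌋)) ^ suc k * 15 ^ (11 * E)
    ≡⟨ ≡.cong₂ _*_ (ℕ.^-*-assoc 2 (2 * ⌊log₂ n ⌋) (suc k)) (≡.sym (ℕ.^-*-assoc 15 11 E)) ⟩
  2 ^ E * (15 ^ 11) ^ E              ≡⟨ ^-distribʳ-* E 2 (15 ^ 11) ⟨
  -- The numerical inequality is decided by evaluation; 11 is the least exponent for which it holds.
  (2 * 15 ^ 11) ^ E                  ≤⟨ ℕ.^-monoˡ-≤ E (ℕ.≤ᵇ⇒≤ (2 * 15 ^ 11) (16 ^ 11) tt) ⟩
  (16 ^ 11) ^ E                      ≡⟨ ℕ.^-*-assoc 16 11 E ⟩
  16 ^ (11 * E)                      ∎
  where
  open ℕ.≤-Reasoning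
  open import Data.Nat.Base using (_*_; _^_)
  E = 2 ℕ.* ⌊log₂ n ⌋ ℕ.* suc k

-- The decay is by nᵏ⁺¹ rather than nᵏ because one factor `n` pays for the initial rank φ ≤ n.
markov : ∀ k n {N S} φ → φ ℕ.≤ n → let R = roundCount k ⌊log₂ n ⌋ in
  16 ℕ.^ R ℕ.* S ℕ.≤ 15 ℕ.^ R ℕ.* (N ℕ.* φ) → n ℕ.^ k ℕ.* S ℕ.≤ N
markov k n {N} {S} φ φ≤n bound = ℕ.*-cancelˡ-≤ (16 ^ R) {{ℕ.m^n≢0 16 R}} (begin
  16 ^ R * (n ^ k * S)       ≡⟨ swap (16 ^ R) (n ^ k) S ⟩
  n ^ k * (16 ^ R * S)       ≤⟨ ℕ.*-monoʳ-≤ (n ^ k) bound ⟩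
  n ^ k * (15 ^ R * (N * φ)) ≤⟨ ℕ.*-monoʳ-≤ (n ^ k) (ℕ.*-monoʳ-≤ (15 ^ R) (ℕ.*-monoʳ-≤ N φ≤n)) ⟩
  n ^ k * (15 ^ R * (N * n)) ≡⟨ regroup (n ^ k) (15 ^ R) N n ⟩
  n ^ suc k * 15 ^ R * N     ≤⟨ ℕ.*-monoˡ-≤ N (decay k n) ⟩
  16 ^ R * N                 ∎)
  where
  open ℕ.≤-Reasoning
  open import Data.Nat.Base using (_*_; _^_)
  R = roundCount k ⌊log₂ n ⌋
  swap : ∀ p q r → p * (q * r) ≡ q * (p * r)
  swap = solve-∀
  regroup : ∀ p q r m → p * (q * (r * m)) ≡ m * p * q * r
  regroup = solve-∀

-- For L ≥ 1 the left side is 22(k+1)L(L² + 5L + 5), and L² + 5L + 5 ≤ 11L² gives the constant 242.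
-- At L = 0 there are no rounds.
depth-bound : ∀ k L → let b = suc L in
  roundCount k L ℕ.* (b ℕ.+ suc b ℕ.* (b ℕ.+ 1)) ℕ.≤ 242 ℕ.* suc k ℕ.* L ℕ.^ 3
depth-bound k zero    = z≤n
depth-bound k (suc L) = ℕ.≤-trans (ℕ.m≤m+n _ (22 ℕ.* suc k ℕ.* suc L ℕ.* (10 ℕ.* L ℕ.* L ℕ.+ 15 ℕ.* L)))
  (ℕ.≤-reflexive (slack k L))
  where
  slack : ∀ k L → 11 ℕ.* (2 ℕ.* suc L ℕ.* suc k) ℕ.* (suc (suc L) ℕ.+ suc (suc (suc L)) ℕ.* (suc (suc L) ℕ.+ 1))
    ℕ.+ 22 ℕ.* suc k ℕ.* suc L ℕ.* (10 ℕ.* L ℕ.* L ℕ.+ 15 ℕ.* L) ≡ 242 ℕ.* suc k ℕ.* (suc L ℕ.* (suc L ℕ.* (suc L ℕ.* 1)))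
  slack = solve-∀

-- Uniform distributions over trees, Markov's inequality and real powers.

module Uniform (ℝ : CompleteOrderedField ℓ) where
  open CompleteOrderedField ℝ hiding (zero)
  open RealPower ℝ
  open PolynomialDecisionTree ℝ
  open Mult semiring using (×-homo-+; ×1-homo-*)
  open Exp commutativeSemiring using (_^_)
  open Sum semiring using (sum)
  open <-Reasoning strictPartialOrder

  fromℕ-mono-≤ : ∀ {m n} → m ℕ.≤ n → fromℕ m ≤ fromℕ n
  fromℕ-mono-≤ m≤n with ℕ.m≤n⇒m<n∨m≡n m≤n
  ... | inj₁ m<n   = inj₁ (fromℕ-mono-< m<n)
  ... | inj₂ ≡.refl = inj₂ refl

  fromℕ-^ : ∀ n k → fromℕ (n ℕ.^ k) ≈ fromℕ n ^ k
  fromℕ-^ n zero    = +-identityʳ 1#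
  fromℕ-^ n (suc k) = trans (×1-homo-* n (n ℕ.^ k)) (*-congˡ (fromℕ-^ n k))

  reciprocal : ∀ {x} → 0# < x → ∃ λ y → 0# < y × x * y ≈ 1#
  reciprocal {x} 0<x with inverse x (λ x≈0 → <-irrefl (sym x≈0) 0<x)
  ... | y , xy≈1 = y , inverse-pos 0<x xy≈1 , xy≈1

  fromℕ-pos : ∀ n .{{_ : NonZero n}} → 0# < fromℕ n
  fromℕ-pos n = 1≤⇒0< (1≤fromℕ n)

  sum-const : ∀ m w → sum {m} (λ _ → w) ≈ fromℕ m * w
  sum-const zero    w = sym (zeroˡ w)
  sum-const (suc m) w = trans (+-cong (sym (*-identityˡ w)) (sum-const m w)) (sym (distribʳ w 1# _))

  foldr-⊔-lub : ∀ {m d} (v : Vector ℕ m) → (∀ i → v i ℕ.≤ d) → Vector.foldr ℕ._⊔_ 0 v ℕ.≤ d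
  foldr-⊔-lub {zero}  v v≤d = z≤n
  foldr-⊔-lub {suc m} v v≤d = ℕ.⊔-lub (v≤d zero) (foldr-⊔-lub (v ∘ suc) (v≤d ∘ suc))

  +-mono-≤ : ∀ {x y u v} → x ≤ y → u ≤ v → x + u ≤ y + v
  +-mono-≤ {y = y} {u} x≤y u≤v = ≤-trans (+-monoˡ-≤ u x≤y) (+-monoʳ-≤ y u≤v)

  -- Markov's inequality at threshold 1: wherever `P` fails, the natural number `f` is nonzero,
  -- hence at least 1.
  sum-markov : ∀ {P : Pred A p} (P? : Decidable P) (l : List A) (f : A → ℕ) {w} → 0# ≤ w →
    (∀ y → f y ≡ 0 → P y) →
    sum (λ k → if does (P? (List.lookup l k)) then 0# else w) ≤ fromℕ (∑ l f) * w
  sum-markov P? []      f {w} 0≤w f≡0⇒P = inj₂ (sym (zeroˡ w))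
  sum-markov P? (y ∷ l) f {w} 0≤w f≡0⇒P = begin
    (if does (P? y) then 0# else w) + sum (λ k → if does (P? (List.lookup l k)) then 0# else w)
      ≤⟨ +-mono-≤ head (sum-markov P? l f 0≤w f≡0⇒P) ⟩
    fromℕ (f y) * w + fromℕ (∑ l f) * w ≈⟨ distribʳ w _ _ ⟨
    (fromℕ (f y) + fromℕ (∑ l f)) * w   ≈⟨ *-congʳ (×-homo-+ 1# (f y) (∑ l f)) ⟨
    fromℕ (f y ℕ.+ ∑ l f) * w ∎
    where
    scaled : ∀ {u v} → u ≤ v → u * w ≤ v * w
    scaled {u} {v} u≤v = case 0≤w
      where
      case : 0# ≤ w → u * w ≤ v * w
      case (inj₁ 0<w) = *-monoˡ-≤ 0<w u≤v
      case (inj₂ 0≈w) = inj₂ (trans (*-congˡ (sym 0≈w)) (trans (zeroʳ u) (trans (sym (zeroʳ v)) (*-congˡ 0≈w))))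

    head : (if does (P? y) then 0# else w) ≤ fromℕ (f y) * w
    head with P? y
    ... | yes _ = ≤-trans (inj₂ (sym (zeroˡ w))) (scaled (0≤fromℕ (f y)))
    ... | no ¬P with f y in fy
    ...   | zero  = ⊥-elim (¬P (f≡0⇒P y fy))
    ...   | suc m = ≤-trans (inj₂ (sym (*-identityˡ w))) (scaled (1≤fromℕ (suc m)))

  -- Here `y` is the power with exponent -k, which lies below -c; it therefore belongs to the set
  -- whose supremum defines the real power.
  power-≥ : ∀ n .{{_ : NonZero n}} c k {y} → c < fromℕ k → 0# < y → fromℕ n ^ k * y ≈ 1# → y ≤ n ^ʳ (- c)
  power-≥ n c k {y} c<k 0<y n^k*y≈1 =
    proj₁ (proj₂ (supremum (RationalPowersUpTo (fromℕ n) (- c))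
        (nonempty (1≤fromℕ n) (- c)) (bounded (1≤fromℕ n) (- c))))
      (0 , k , 1 , _ , inj₁ exponent , 0<y , trans (*-congʳ (*-identityʳ y)) (trans (*-comm y _) n^k*y≈1))
    where
    exponent : 0# < fromℕ 1 * (- c) + fromℕ k
    exponent = begin-strict
      0#                        ≈⟨ -‿inverseˡ c ⟨
      - c + c                   <⟨ +-monoʳ-< (- c) c<k ⟩
      - c + fromℕ k             ≈⟨ +-congʳ (*-identityˡ (- c)) ⟨
      1# * (- c) + fromℕ k      ≈⟨ +-congʳ (*-congʳ (+-identityʳ 1#)) ⟨
      fromℕ 1 * (- c) + fromℕ k ∎

  module _ {n : ℕ} {Ω : Set} (l : List Ω) .{{_ : NonZero (length l)}} (t : Ω → Tree n) where

    private
      w = reciprocal (fromℕ-pos (length l))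

    uniform : RandomizedTree n
    uniform = record
      { size       = length l
      ; tree       = λ k → t (List.lookup l k)
      ; weight     = λ _ → proj₁ w
      ; weight≥0   = λ _ → inj₁ (proj₁ (proj₂ w))
      ; sum-weight = trans (sum-const (length l) (proj₁ w)) (proj₂ (proj₂ w))
      }

    open RandomizedTree uniform

    uniform-depth : ∀ {d} → (∀ ω → depth (t ω) ℕ.≤ d) → randomizedDepth ℕ.≤ d
    uniform-depth t≤d = foldr-⊔-lub (λ k → depth (t (List.lookup l k))) (λ k → t≤d _)

    -- The hypothesis says that `f` has mean at most 1/q. Since `f` vanishes only on seeds that give
    -- a maximum, Markov's inequality bounds the failure probability by 1/q, represented by `y`.
    uniform-failure : ∀ x (f : Ω → ℕ) → (∀ ω → f ω ≡ 0 → IsMaximum x (output (t ω) x)) →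
      ∀ q .{{_ : NonZero q}} {y} → q ℕ.* ∑ l f ℕ.≤ length l → 0# < y → fromℕ q * y ≈ 1# → failureProbability x ≤ y
    uniform-failure x f f≡0⇒max q {y} qS≤N 0<y qy≈1 = begin
      failureProbability x
        ≤⟨ sum-markov (λ ω → isMaximum? x (output (t ω) x)) l f (inj₁ 0<w) f≡0⇒max ⟩
      fromℕ S * v ≈⟨ *-congʳ (*-identityˡ _) ⟨
      1# * fromℕ S * v ≈⟨ *-congʳ (*-congʳ (trans (*-comm y _) qy≈1)) ⟨
      y * fromℕ q * fromℕ S * v ≈⟨ *-congʳ (*-assoc y _ _) ⟩
      y * (fromℕ q * fromℕ S) * v ≈⟨ *-congʳ (*-congˡ (×1-homo-* q S)) ⟨
      y * fromℕ (q ℕ.* S) * v ≈⟨ *-congʳ (*-comm y _) ⟩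
      fromℕ (q ℕ.* S) * y * v ≤⟨ *-monoˡ-≤ 0<w (*-monoˡ-≤ 0<y (fromℕ-mono-≤ qS≤N)) ⟩
      fromℕ (length l) * y * v ≈⟨ *-congʳ (*-comm _ y) ⟩
      y * fromℕ (length l) * v ≈⟨ *-assoc y _ _ ⟩
      y * (fromℕ (length l) * v) ≈⟨ *-congˡ (proj₂ (proj₂ w)) ⟩
      y * 1# ≈⟨ *-identityʳ y ⟩
      y ∎
      where
      S = ∑ l f
      v = proj₁ w
      0<w = proj₁ (proj₂ w)

-- Choice of parameters and assembly of the result.

module Maximum (ℝ : CompleteOrderedField ℓ) (n : ℕ) .{{n≢0 : NonZero n}} (k : ℕ) where
  open CompleteOrderedField ℝ hiding (zero)
  open RealPower ℝ using (fromℕ)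
  open PolynomialDecisionTree ℝ
  open Trees ℝ n
  open Algorithm ℝ n
  open Uniform ℝ

  private
    L b T R : ℕ
    L = ⌊log₂ n ⌋
    b = suc L
    T = suc b
    R = roundCount k L

    n<2^b : n ℕ.< 2 ℕ.^ b
    n<2^b = n<2^[1+⌊log₂n⌋] n

    code : Fin n → Fin b → Fin 2
    code = digits b (ℕ.<⇒≤ n<2^b)

    i₀ : Fin n
    i₀ = fromℕ< (ℕ.>-nonZero⁻¹ n)

    rows : List (Vec (Vec Bool T) n)
    rows = tuples n (bitStrings T)

    -- One seed supplies, for every round and every index, `T` fair bits that determine its
    -- membership at all densities.
    seeds : List (Vec (Vec (Vec Bool T) n) R)
    seeds = tuples R rows

    seeds≢0 : NonZero (length seeds)
    seeds≢0 = tuples≢0 R rows (tuples≢0 n (bitStrings T) (tuples≢0 T (true ∷ false ∷ []) _))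
      where
      tuples≢0 : ∀ {A : Set} m (l : List A) → NonZero (length l) → NonZero (length (tuples m l))
      tuples≢0 m l l≢0 = subst NonZero (≡.sym (length-tuples m l)) (ℕ.m^n≢0 (length l) m {{l≢0}})

    tree : Vec (Vec (Vec Bool T) n) R → Tree n
    tree ωs = toTree (rounds code ωs i₀)

  maximumTree : RandomizedTree n
  maximumTree = uniform seeds {{seeds≢0}} tree

  maximumTree-depth : RandomizedTree.randomizedDepth maximumTree ℕ.≤ 242 ℕ.* suc k ℕ.* L ℕ.^ 3
  maximumTree-depth = uniform-depth seeds {{seeds≢0}} tree
    λ ωs → ℕ.≤-trans (depth-toTree (rounds code ωs i₀)) (depth-bound k L)

  maximumTree-failure : ∀ x {y} → 0# < y → fromℕ (n ℕ.^ k) * y ≈ 1# →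
    RandomizedTree.failureProbability maximumTree x ≤ y
  maximumTree-failure x = uniform-failure seeds {{seeds≢0}} tree x (λ ωs → Φ (iterate s ωs i₀))
    (λ ωs Φ≡0 → subst (IsMaximum x) (≡.sym (≡.trans (output-toTree x (rounds code ωs i₀)) (run-rounds code inj ωs i₀)))
      (Φ≡0⇒maximum Φ≡0))
    (n ℕ.^ k) {{ℕ.m^n≢0 n k}} counted
    where
    open Correctness x
    inj = digits-injective b (ℕ.<⇒≤ n<2^b)
    s = step {b} {T} code inj

    counted : n ℕ.^ k ℕ.* ∑ seeds (λ ωs → Φ (iterate s ωs i₀)) ℕ.≤ length seeds
    counted = markov k n (Φ i₀) (Φ≤n i₀) (subst
      (λ N → 16 ℕ.^ R ℕ.* ∑ seeds (λ ωs → Φ (iterate s ωs i₀)) ℕ.≤ 15 ℕ.^ R ℕ.* (N ℕ.* Φ i₀))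
      (≡.sym (length-tuples R rows))
      (iterate-contracts rows s Φ 16 15 (step-contracts code inj n<2^b ≡.refl) R i₀))

theorem1 : ∀ {ℓ} (ℝ : CompleteOrderedField ℓ) →
    let open CompleteOrderedField ℝ
        open RealPower ℝ using (_^ʳ_)
        open PolynomialDecisionTree ℝ
        open RandomizedTree
    in
    (c : Carrier) → 0# < c →
    ∃ λ (D : ℕ) → ∃ λ (K : Carrier) →
    ∀ (n : ℕ) .{{_ : NonZero n}} →
    ∃ λ (T : RandomizedTree n) →
      randomizedDepth T ℕ.≤ D ℕ.* ⌊log₂ n ⌋ ℕ.^ 3
      × (∀ (x : Fin n → Carrier) → failureProbability T x ≤ K * n ^ʳ (- c))
theorem1 ℝ c _ with RealPower.archimedean ℝ c
-- An integer exponent k > c suffices: n⁻ᵏ is at most n⁻ᶜ for every n ≥ 1, so the constant in the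
-- failure bound can be 1.
... | k , c<k = 242 ℕ.* suc k , 1# , λ n → maximumTree n k , maximumTree-depth n k , failure n
  where
  open CompleteOrderedField ℝ
  open RealPower ℝ using (_^ʳ_)
  open PolynomialDecisionTree ℝ
  open RandomizedTree
  open Uniform ℝ
  open Maximum ℝ

  failure : ∀ n .{{_ : NonZero n}} x → failureProbability (maximumTree n k) x ≤ 1# * n ^ʳ (- c)
  failure n x with reciprocal (fromℕ-pos (n ℕ.^ k) {{ℕ.m^n≢0 n k}})
  ... | y , 0<y , n^k*y≈1 = ≤-trans (maximumTree-failure n k x 0<y n^k*y≈1)
    (≤-trans (power-≥ n c k c<k 0<y (trans (*-congʳ (sym (fromℕ-^ n k))) n^k*y≈1)) (inj₂ (sym (*-identityˡ _))))
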